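{- For every $k\ge1$, the class of all graphs admitting a tree decomposition of width at most $k$ and adhesion at most $1$ is homomorphism distinguishing closed.
   Context: All graphs are finite, simple, undirected and loopless. A tree decomposition $(T,\beta)$ of $G$ has width $\max_{t}|\beta(t)|-1$ and adhesion $\max_{tt'\in E(T)}|\beta(t)\cap\beta(t')|$. $\hom(F,G)$ is the number of homomorphisms $F\to G$; $G\equiv_{\mathcal{C}}H$ means $\hom(F,G)=\hom(F,H)$ for all $F\in\mathcal{C}$. A graph class $\mathcal{C}$ is homomorphism distinguishing closed if for every graph $F'\notin\mathcal{C}$ there exist graphs $G,H$ with $G\equiv_{\mathcal{C}}H$ and $\hom(F',G)\neq\hom(F',H)$. -}

module Defs where

open import Data.Nat using (ℕ; zero; suc; _≤_)
open import Data.Bool using (Bool; true; false; _∧_; _∨_; not)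
open import Data.Fin using (Fin; zero; suc; inject₁; fromℕ)
open import Data.Fin.Subset using (Subset; _∈_; _∩_; ∣_∣)
open import Data.List using (List; []; _∷_; map; concatMap; length; filterᵇ; allFin)
open import Data.Bool.ListAction using (and)
import Data.Vec.Functional as VF
open import Data.Product using (Σ; _×_; _,_)
open import Relation.Binary.PropositionalEquality using (_≡_; _≢_)
open import Relation.Nullary using (¬_)
open import Data.Unit using (⊤)

record Graph : Set where
  field
    size  : ℕ
    adj   : Fin size → Fin size → Bool
    sym   : ∀ u v → adj u v ≡ adj v u
    loopless : ∀ v → adj v v ≡ false
open Graph public

V : Graph → Set
V G = Fin (size G)

Adj : (G : Graph) → V G → V G → Set
Adj G u v = adj G u v ≡ true

allMaps : (n m : ℕ) → List (Fin n → Fin m)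
allMaps zero    m = (λ ()) ∷ []
allMaps (suc n) m = concatMap (λ f → map (λ i → i VF.∷ f) (allFin m)) (allMaps n m)

isHom : (F G : Graph) → (V F → V G) → Bool
isHom F G f = and (concatMap (λ u → map (λ v → not (adj F u v) ∨ adj G (f u) (f v)) (allFin (size F))) (allFin (size F)))

hom : Graph → Graph → ℕ
hom F G = length (filterᵇ (isHom F G) (allMaps (size F) (size G)))

data WalkIn (G : Graph) (P : V G → Set) : V G → V G → Set where
  here : ∀ {v} → P v → WalkIn G P v v
  step : ∀ {u w v} → P u → Adj G u w → WalkIn G P w v → WalkIn G P u v

Connected : Graph → Set
Connected G = ∀ u v → WalkIn G (λ _ → ⊤) u v

record Cycle (G : Graph) : Set where
  field
    m     : ℕ
    vs    : Fin (suc (suc (suc m))) → V G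
    inj   : ∀ i j → vs i ≡ vs j → i ≡ j
    edges : ∀ (i : Fin (suc (suc m))) → Adj G (vs (inject₁ i)) (vs (suc i))
    close : Adj G (vs (fromℕ (suc (suc m)))) (vs zero)

IsTree : Graph → Set
IsTree T = Connected T × ¬ Cycle T

record TreeDecomposition (G : Graph) : Set where
  field
    T       : Graph
    isTree  : IsTree T
    bag     : V T → Subset (size G)
    covers  : ∀ (v : V G) → Σ (V T) λ t → v ∈ bag t
    edgeIn  : ∀ (u v : V G) → Adj G u v → Σ (V T) λ t → (u ∈ bag t) × (v ∈ bag t)
    subtree : ∀ (v : V G) (s s' : V T) → v ∈ bag s → v ∈ bag s' →
              WalkIn T (λ t → v ∈ bag t) s s'
open TreeDecomposition public

WidthAtMost : ∀ {G} → ℕ → TreeDecomposition G → Set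
WidthAtMost k D = ∀ t → ∣ bag D t ∣ ≤ suc k

AdhesionAtMost : ∀ {G} → ℕ → TreeDecomposition G → Set
AdhesionAtMost a D = ∀ s t → Adj (T D) s t → ∣ bag D s ∩ bag D t ∣ ≤ a

TW-Adh1 : ℕ → Graph → Set
TW-Adh1 k G = Σ (TreeDecomposition G) λ D → WidthAtMost k D × AdhesionAtMost 1 D

HomIndist : (Graph → Set) → Graph → Graph → Set
HomIndist C G H = ∀ F → C F → hom F G ≡ hom F H

HomDistClosed : (Graph → Set) → Set
HomDistClosed C = ∀ F' → ¬ C F' →
  Σ Graph λ G → Σ Graph λ H → HomIndist C G H × hom F' G ≢ hom F' H

{-# OPTIONS --safe #-}
module Submission where

-- Suppose F' is not in the class. A vertex set W with at most k + 1 vertices is a single bag, and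
-- a separation of W of order at most 1 lets decompositions of its two sides be glued along an edge;
-- so some W with at least k + 2 vertices has no such separation. Over F' put the CFI-style graph
-- X(U) with vertices (v , S), where S marks edges of F'[W] at v, the parity of S being U v.
-- Translation by one lift of φ : F → F' to X(U) is a bijection between the lifts of φ to X(0) and
-- to X(U). Take U to be the indicator of one vertex of W. The identity of F' has no lift to X(U),
-- by the handshake lemma, so hom(F', X(U)) < hom(F', X(0)). If F is in the class, every φ lifts, one
-- bag at a time: the image of a bag misses some w ∈ W, and since W minus any one vertex is
-- connected, a T-join absorbing the parity defect at w realises U on the bag while agreeing with
-- the label already fixed at the at most one vertex shared with earlier bags.

open import Defs
open import Algebra.Bundles using (CommutativeRing)
open import Data.Bool using (Bool; true; false; _∧_; _∨_; not; _xor_)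
open import Data.Bool.ListAction using (and)
open import Data.Bool.Properties
  using (T?; T-≡; ∧-comm; ∧-zeroʳ; ∧-distribˡ-xor; xor-assoc; xor-comm; xor-same; xor-identityʳ;
         xor-∧-commutativeRing)
  renaming (_≟_ to _≟ᵇ_)
open import Algebra.Properties.Semiring.Sum (CommutativeRing.semiring xor-∧-commutativeRing)
  using (sum; sum-cong-≗; sum-replicate-zero; ∑-distrib-+; ∑-comm; *-distribˡ-sum)
open import Data.Empty using (⊥-elim)
open import Data.Fin
  using (Fin; zero; suc; toℕ; fromℕ; inject₁; _↑ˡ_; _↑ʳ_; splitAt; join; combine; quotient; remainder;
         funToFin; finToFun)
open import Data.Fin.Properties
  using (_≟_; all?; any?; injective⇒≤; suc-injective; toℕ-injective; toℕ-inject₁; toℕ<n; toℕ-↑ˡ; toℕ-↑ʳ;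
         splitAt-↑ˡ; splitAt-↑ʳ; join-splitAt;
         2↔Bool; combine-remQuot; remQuot-combine; finToFun-funToFin; funToFin-finToFin)
open import Data.Fin.Relation.Unary.Top using (view; ‵fromℕ; ‵inject₁)
open import Data.Fin.Subset using (Subset; _∈_; _∉_; _⊆_; _⊂_; _⊃_; _∪_; _∩_; ∁; ⁅_⁆; ⊤; ⊥; ∣_∣; inside; outside)
open import Data.Fin.Subset.Induction using (Acc; acc; ⊂-wellFounded; ⊃-wellFounded)
open import Data.Fin.Subset.Properties
open import Data.List
  using (List; []; _∷_; _++_; map; concatMap; cartesianProductWith; length; lookup; filterᵇ; allFin)
open import Data.List.Membership.Propositional using (find)
open import Data.List.Membership.Propositional.Properties using (∈-allFin; ∈-lookup)
import Data.List.Membership.Setoid as Mem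
import Data.List.Membership.Setoid.Properties as Membership
open import Data.List.Properties using (length-map)
open import Data.List.Relation.Unary.All as All using (All; []; _∷_)
import Data.List.Relation.Unary.All.Properties as All
import Data.List.Relation.Unary.AllPairs as AllPairs
open import Data.List.Relation.Unary.Any as Any using (Any; here; index)
import Data.List.Relation.Unary.Unique.Propositional.Properties as UniqueP
open import Data.List.Relation.Unary.Unique.Setoid using (Unique)
import Data.List.Relation.Unary.Unique.Setoid.Properties as Unique
open import Data.Nat using (ℕ; zero; suc; _+_; _*_; _^_; _≤_; _<_; z≤n; s≤s; s≤s⁻¹; _≤?_)
open import Data.Nat.Properties
  using (≤-refl; ≤-reflexive; ≤-trans; ≤-antisym; ≤-total; <⇒≱; <⇒≢; ≰⇒>; n≤1+n; n≤0⇒n≡0; m≤m+n; m≢1+n+m;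
         +-suc; +-mono-≤; +-monoʳ-≤; +-cancelˡ-≤)
open import Data.Product using (Σ; ∃; _×_; _,_; proj₁; proj₂)
open import Data.Sum using (_⊎_; inj₁; inj₂; [_,_]′)
open import Data.Vec using (Vec; []; _∷_; here; there; tabulate)
import Data.Vec as Vec
import Data.Vec.Functional as VF
open import Data.Vec.Properties using (lookup∘tabulate; tabulate-cong)
open import Function using (_∘_; id; mk⇔; Equivalence; Inverse)
open import Level using (Level)
open import Relation.Binary using (Setoid)
open import Relation.Binary.PropositionalEquality
  using (_≡_; _≢_; _≗_; refl; trans; cong; cong₂; subst; subst₂; setoid; _→-setoid_;
         module ≡-Reasoning) renaming (sym to ≡-sym)
open import Relation.Nullary using (¬_; Dec; yes; no; does; contradiction)
open import Relation.Nullary.Decidable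
  using (_×-dec_; _→-dec_; _⊎-dec_; ¬?; does-⇔; dec-true; dec-false; decidable-stable)

-- Counting homomorphisms

module _ {a ℓ : Level} (S : Setoid a ℓ) where
  open Setoid S using (_≈_) renaming (sym to ≈-sym)
  open Mem S using () renaming (_∈_ to _∈ₗ_)

  lookup-injective : ∀ {xs} → Unique S xs → ∀ i j → lookup xs i ≈ lookup xs j → i ≡ j
  lookup-injective (x∉ AllPairs.∷ xs!) zero    zero    eq = refl
  lookup-injective (x∉ AllPairs.∷ xs!) zero    (suc j) eq = contradiction eq (All.lookup x∉ (∈-lookup j))
  lookup-injective (x∉ AllPairs.∷ xs!) (suc i) zero    eq = contradiction (≈-sym eq) (All.lookup x∉ (∈-lookup i))
  lookup-injective (x∉ AllPairs.∷ xs!) (suc i) (suc j) eq = cong suc (lookup-injective xs! i j eq)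

  -- Sending each entry of `xs` to a position where it occurs in `ys` is injective, because `xs` has
  -- no repetitions.
  length-mono-≤ : ∀ {xs ys} → Unique S xs → All (_∈ₗ ys) xs → length xs ≤ length ys
  length-mono-≤ {xs} xs! xs⊆ys = injective⇒≤ {f = λ i → index (pos i)} λ {i} {j} eq →
    lookup-injective xs! i j (Membership.index-injective S (pos i) (pos j) eq)
    where pos = λ i → All.lookup xs⊆ys (∈-lookup {xs = xs} i)

concatMap-map≡cartesianProductWith : ∀ {A B C : Set} (f : A → B → C) xs ys →
  concatMap (λ x → map (f x) ys) xs ≡ cartesianProductWith f xs ys
concatMap-map≡cartesianProductWith f []       ys = refl
concatMap-map≡cartesianProductWith f (x ∷ xs) ys =
  cong (map (f x) ys ++_) (concatMap-map≡cartesianProductWith f xs ys)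

-- Maps are compared pointwise: a given function need not be propositionally equal to its copy in
-- `allMaps`.
Maps : ℕ → ℕ → Setoid _ _
Maps n m = Fin n →-setoid Fin m

allMaps! : ∀ n m → Unique (Maps n m) (allMaps n m)
allMaps! zero    m = [] AllPairs.∷ AllPairs.[]
allMaps! (suc n) m =
  subst (Unique (Maps (suc n) m)) (≡-sym (concatMap-map≡cartesianProductWith _ (allMaps n m) (allFin m)))
  (Unique.cartesianProductWith⁺ (Maps n m) (setoid (Fin m)) (Maps (suc n) m) _
    (λ eq → eq ∘ suc , eq zero) (allMaps! n m) (UniqueP.allFin⁺ m))

∈-allMaps : ∀ n m (f : Fin n → Fin m) → Mem._∈_ (Maps n m) f (allMaps n m)
∈-allMaps zero    m f = here λ ()
∈-allMaps (suc n) m f =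
  subst (Mem._∈_ (Maps (suc n) m) f) (≡-sym (concatMap-map≡cartesianProductWith _ (allMaps n m) (allFin m)))
  (Membership.∈-resp-≈ (Maps (suc n) m) {x = f zero VF.∷ f ∘ suc} (λ { zero → refl ; (suc i) → refl })
    (Membership.∈-cartesianProductWith⁺ (Maps n m) (setoid (Fin m)) (Maps (suc n) m)
      (λ { p refl zero → refl ; p refl (suc i) → p i })
      (∈-allMaps n m (f ∘ suc)) (∈-allFin (f zero))))

IsHom : (F G : Graph) → (V F → V G) → Set
IsHom F G f = ∀ u v → Adj F u v → Adj G (f u) (f v)

IsHom-resp-≗ : ∀ F G {f g} → f ≗ g → IsHom F G f → IsHom F G g
IsHom-resp-≗ F G f≗g h u v a = trans (≡-sym (cong₂ (adj G) (f≗g u) (f≗g v))) (h u v a)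

and⁺ : ∀ {bs} → All (_≡ true) bs → and bs ≡ true
and⁺ []         = refl
and⁺ (refl ∷ p) = and⁺ p

and⁻ : ∀ {bs} → and bs ≡ true → All (_≡ true) bs
and⁻ {[]}       eq = []
and⁻ {true ∷ _} eq = refl ∷ and⁻ eq

module _ (F G : Graph) (f : V F → V G) where

  private
    edgeOK : V F → V F → Bool
    edgeOK u v = not (adj F u v) ∨ adj G (f u) (f v)

  isHom⁺ : IsHom F G f → isHom F G f ≡ true
  isHom⁺ h = and⁺ (All.concat⁺
      (All.map⁺ (All.universal (λ u → All.map⁺ (All.universal (ok u) (allFin (size F)))) (allFin (size F)))))
    where
    ok : ∀ u v → edgeOK u v ≡ true
    ok u v with adj F u v in eq
    ... | false = refl
    ... | true  = h u v eq

  isHom⁻ : isHom F G f ≡ true → IsHom F G f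
  isHom⁻ eq u v a =
    ok (All.lookup (All.map⁻ (All.lookup (All.map⁻ (All.concat⁻ (and⁻ eq))) (∈-allFin u))) (∈-allFin v))
    where
    ok : edgeOK u v ≡ true → Adj G (f u) (f v)
    ok p rewrite a = p

module _ (F G : Graph) where

  homs : List (V F → V G)
  homs = filterᵇ (isHom F G) (allMaps (size F) (size G))

  homs! : Unique (Maps (size F) (size G)) homs
  homs! = Unique.filter⁺ (Maps (size F) (size G)) (T? ∘ isHom F G) (allMaps! (size F) (size G))

  IsHom⇒∈homs : ∀ {f} → IsHom F G f → Mem._∈_ (Maps (size F) (size G)) f homs
  IsHom⇒∈homs {f} h = Membership.∈-filter⁺ (Maps (size F) (size G)) (T? ∘ isHom F G)
    (λ {g} {g'} g≗g' t → Equivalence.from T-≡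
        (isHom⁺ F G g' (IsHom-resp-≗ F G g≗g' (isHom⁻ F G g (Equivalence.to T-≡ t)))))
    (∈-allMaps (size F) (size G) f) (Equivalence.from T-≡ (isHom⁺ F G f h))

  all-homs : All (IsHom F G) homs
  all-homs = All.map (λ {f} t → isHom⁻ F G f (Equivalence.to T-≡ t))
      (All.all-filter (T? ∘ isHom F G) (allMaps (size F) (size G)))

module _ (F : Graph) {G H : Graph} (Φ : (V F → V G) → (V F → V H))
         (Φ-hom : ∀ f → IsHom F G f → IsHom F H (Φ f))
         (Φ-inj : ∀ {f g} → Φ f ≗ Φ g → f ≗ g) where

  private
    images! : Unique (Maps (size F) (size H)) (map Φ (homs F G))
    images! = Unique.map⁺ (Maps (size F) (size G)) (Maps (size F) (size H)) Φ-inj (homs! F G)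

    images⊆homs : All (λ f → Mem._∈_ (Maps (size F) (size H)) f (homs F H)) (map Φ (homs F G))
    images⊆homs = All.map⁺ (All.map (λ {f} h → IsHom⇒∈homs F H (Φ-hom f h)) (all-homs F G))

  hom-mono-≤ : hom F G ≤ hom F H
  hom-mono-≤ = ≤-trans (≤-reflexive (≡-sym (length-map Φ (homs F G))))
      (length-mono-≤ (Maps (size F) (size H)) images! images⊆homs)

  -- A homomorphism missed by `Φ` can be put in front of the list of images without creating a
  -- repetition.
  hom-mono-< : ∀ h → IsHom F H h → (∀ f → IsHom F G f → ¬ h ≗ Φ f) → hom F G < hom F H
  hom-mono-< h h-hom fresh = ≤-trans (≤-reflexive (cong suc (≡-sym (length-map Φ (homs F G)))))
    (length-mono-≤ (Maps (size F) (size H)) {h ∷ map Φ (homs F G)}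
        (All.map⁺ (All.map (λ {f} → fresh f) (all-homs F G)) AllPairs.∷ images!)
      (IsHom⇒∈homs F H h-hom ∷ images⊆homs))

-- Twisted graphs

does-true⁻ : ∀ {A : Set} (a? : Dec A) → does a? ≡ true → A
does-true⁻ (yes a) _ = a

does-∧-cong : ∀ {A : Set} (a? : Dec A) {x y} → (A → x ≡ y) → does a? ∧ x ≡ does a? ∧ y
does-∧-cong (yes a) eq = eq a
does-∧-cong (no _)  eq = refl

funToFin-cong : ∀ {m n} {f g : Fin m → Fin n} → f ≗ g → funToFin f ≡ funToFin g
funToFin-cong {zero}  f≗g = refl
funToFin-cong {suc m} f≗g = cong₂ combine (f≗g zero) (funToFin-cong (f≗g ∘ suc))

xor-cancelʳ : ∀ x y z → x xor z ≡ y xor z → x ≡ y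
xor-cancelʳ false false z     eq = refl
xor-cancelʳ true  true  z     eq = refl
xor-cancelʳ true  false false ()
xor-cancelʳ true  false true  ()
xor-cancelʳ false true  false ()
xor-cancelʳ false true  true  ()

-- (v , S) is stored as a number so that it can be a vertex of a Graph.
module Labelled (n : ℕ) where

  Point : Set
  Point = Fin (n * 2 ^ n)

  point : Fin n → (Fin n → Bool) → Point
  point v S = combine v (funToFin (Inverse.from 2↔Bool ∘ S))

  base : Point → Fin n
  base = quotient (2 ^ n)

  label : Point → Fin n → Bool
  label p = Inverse.to 2↔Bool ∘ finToFun (remainder {n} (2 ^ n) p)

  base-point : ∀ v S → base (point v S) ≡ v
  base-point v S = cong proj₁ (remQuot-combine {n} v _)

  label-point : ∀ v S → label (point v S) ≗ S
  label-point v S i = begin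
    Inverse.to 2↔Bool (finToFun (remainder {n} (2 ^ n) (point v S)) i)
      ≡⟨ cong (λ vs → Inverse.to 2↔Bool (finToFun (proj₂ vs) i)) (remQuot-combine {n} v _) ⟩
    Inverse.to 2↔Bool (finToFun (funToFin (Inverse.from 2↔Bool ∘ S)) i)
      ≡⟨ cong (Inverse.to 2↔Bool) (finToFun-funToFin (Inverse.from 2↔Bool ∘ S) i) ⟩
    Inverse.to 2↔Bool (Inverse.from 2↔Bool (S i))
      ≡⟨ Inverse.strictlyInverseˡ 2↔Bool (S i) ⟩
    S i ∎
    where open ≡-Reasoning

  point-base-label : ∀ p → point (base p) (label p) ≡ p
  point-base-label p = begin
    combine (base p) (funToFin (Inverse.from 2↔Bool ∘ label p))
      ≡⟨ cong (combine (base p)) (funToFin-cong {n} (λ i → Inverse.strictlyInverseʳ 2↔Bool (finToFun code i))) ⟩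
    combine (base p) (funToFin (finToFun {2} {n} code))
      ≡⟨ cong (combine (base p)) (funToFin-finToFin {n} {2} code) ⟩
    combine (base p) code
      ≡⟨ combine-remQuot {n} (2 ^ n) p ⟩
    p ∎
    where
    open ≡-Reasoning
    code = remainder {n} (2 ^ n) p

  point-ext : ∀ {p q} → base p ≡ base q → label p ≗ label q → p ≡ q
  point-ext {p} {q} b l = begin
    p                        ≡⟨ ≡-sym (point-base-label p) ⟩
    point (base p) (label p) ≡⟨ cong₂ combine b (funToFin-cong {n} (λ i → cong (Inverse.from 2↔Bool) (l i))) ⟩
    point (base q) (label q) ≡⟨ point-base-label q ⟩
    q                        ∎
    where open ≡-Reasoning

  infixl 6 _⊕_
  _⊕_ : Point → (Fin n → Bool) → Point
  p ⊕ S = point (base p) (λ i → label p i xor S i)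

  ⊕-cancel : ∀ {p q S S'} → base p ≡ base q → S ≗ S' → p ⊕ S ≡ q ⊕ S' → p ≡ q
  ⊕-cancel {p} {q} {S} {S'} b S≗S' eq = point-ext b λ i → xor-cancelʳ _ _ (S i) (begin
    label p i xor S i    ≡⟨ ≡-sym (label-point _ _ i) ⟩
    label (p ⊕ S) i      ≡⟨ cong (λ r → label r i) eq ⟩
    label (q ⊕ S') i     ≡⟨ label-point _ _ i ⟩
    label q i xor S' i   ≡⟨ cong (label q i xor_) (≡-sym (S≗S' i)) ⟩
    label q i xor S i    ∎)
    where open ≡-Reasoning

module Twist (G : Graph) (W : Subset (size G)) where

  open Labelled (size G) public

  E : V G → V G → Set
  E u v = Adj G u v × u ∈ W × v ∈ W

  E? : ∀ u v → Dec (E u v)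
  E? u v = (adj G u v ≟ᵇ true) ×-dec (u ∈? W) ×-dec (v ∈? W)

  E-sym : ∀ {u v} → E u v → E v u
  E-sym {u} {v} (a , p , q) = trans (sym G v u) a , q , p

  E-irrefl : ∀ {u} → ¬ E u u
  E-irrefl {u} (a , _) with adj G u u | loopless G u
  E-irrefl {u} (() , _) | .false | refl

  -- `sum` is taken over 𝔽₂, so this is the parity of the number of `E`-edges at `v` marked by `S`,
  -- an edge at `v` being named by its other end.
  degree : V G → (V G → Bool) → Bool
  degree v S = sum (λ u → does (E? v u) ∧ S u)

  degree-cong : ∀ v {S S'} → (∀ u → E v u → S u ≡ S' u) → degree v S ≡ degree v S'
  degree-cong v eq = sum-cong-≗ λ u → does-∧-cong (E? v u) (eq u)

  degree-xor : ∀ v S S' → degree v (λ u → S u xor S' u) ≡ degree v S xor degree v S'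
  degree-xor v S S' = trans (sum-cong-≗ (λ u → ∧-distribˡ-xor (does (E? v u)) (S u) (S' u)))
    (∑-distrib-+ (λ u → does (E? v u) ∧ S u) (λ u → does (E? v u) ∧ S' u))

  degree-0 : ∀ v → degree v (λ _ → false) ≡ false
  degree-0 v = trans (sum-cong-≗ (λ u → ∧-zeroʳ (does (E? v u)))) (sum-replicate-zero (size G))

  -- All edges of `G` are kept in the base, but only those inside `W` carry a bit on which both ends
  -- must agree.
  Link : (V G → Bool) → Point → Point → Set
  Link U p q = Adj G (base p) (base q)
    × (degree (base p) (label p) ≡ U (base p) × degree (base q) (label q) ≡ U (base q))
    × (E (base p) (base q) → label p (base q) ≡ label q (base p))

  Link? : ∀ U p q → Dec (Link U p q)
  Link? U p q = (adj G (base p) (base q) ≟ᵇ true)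
    ×-dec ((degree (base p) (label p) ≟ᵇ U (base p)) ×-dec (degree (base q) (label q) ≟ᵇ U (base q)))
    ×-dec (E? (base p) (base q) →-dec (label p (base q) ≟ᵇ label q (base p)))

  Link-sym : ∀ {U p q} → Link U p q → Link U q p
  Link-sym {U} {p} {q} (a , (dp , dq) , l) = trans (sym G (base q) (base p)) a , (dq , dp) , λ e → ≡-sym (l (E-sym e))

  -- Points of the wrong parity stay as isolated vertices, so that the vertex set does not depend
  -- on U; entries of a label away from E are never read.
  twisted : (V G → Bool) → Graph
  twisted U = record
    { size     = size G * 2 ^ size G
    ; adj      = λ p q → does (Link? U p q)
    ; sym      = λ p q → does-⇔ (mk⇔ (Link-sym {U}) (Link-sym {U})) (Link? U p q) (Link? U q p)
    ; loopless = λ p → dec-false (Link? U p p) λ (a , _) → contradiction (trans (≡-sym a) (loopless G (base p))) λ ()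
    }

  -- A lift of φ : F → G to the twisted graph, recorded by its labels.
  Lift : (V G → Bool) → (F : Graph) → (V F → V G) → (V F → V G → Bool) → Set
  Lift U F φ ζ = ∀ x y → Adj F x y →
    degree (φ x) (ζ x) ≡ U (φ x) × (E (φ x) (φ y) → ζ x (φ y) ≡ ζ y (φ x))

  Lift-resp-≗ : ∀ {U F φ φ' ζ} → φ ≗ φ' → Lift U F φ ζ → Lift U F φ' ζ
  Lift-resp-≗ {U} {F} {φ} {φ'} {ζ} eq l x y a =
    subst₂ (λ u v → degree u (ζ x) ≡ U u × (E u v → ζ x v ≡ ζ y u)) (eq x) (eq y) (l x y a)

  module _ (U : V G → Bool) (F : Graph) where

    hom-base : ∀ f → IsHom F (twisted U) f → IsHom F G (base ∘ f)
    hom-base f h x y a = proj₁ (does-true⁻ (Link? U (f x) (f y)) (h x y a))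

    hom⇒Lift : ∀ f → IsHom F (twisted U) f → Lift U F (base ∘ f) (label ∘ f)
    hom⇒Lift f h x y a = let (_ , (d , _) , l) = does-true⁻ (Link? U (f x) (f y)) (h x y a) in d , l

    Lift⇒hom : ∀ f → IsHom F G (base ∘ f) → Lift U F (base ∘ f) (label ∘ f) → IsHom F (twisted U) f
    Lift⇒hom f h l x y a = dec-true (Link? U (f x) (f y))
      (h x y a , (proj₁ (l x y a) , proj₁ (l y x (trans (sym F y x) a))) , proj₂ (l x y a))

    Lift⇒hom-point : ∀ φ ζ → IsHom F G φ → Lift U F φ ζ → IsHom F (twisted U) (λ x → point (φ x) (ζ x))
    Lift⇒hom-point φ ζ h l = Lift⇒hom _ (IsHom-resp-≗ F G (λ x → ≡-sym (base-point (φ x) (ζ x))) h)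
      (Lift-resp-≗ {U} {F} (λ x → ≡-sym (base-point (φ x) (ζ x))) λ x y a →
        trans (degree-cong (φ x) (λ u _ → label-point (φ x) (ζ x) u)) (proj₁ (l x y a))
        , λ e → trans (label-point _ _ (φ y)) (trans (proj₂ (l x y a) e) (≡-sym (label-point _ _ (φ x)))))

  -- The parity conditions are affine and the agreement conditions linear over 𝔽₂, so adding a lift
  -- for `U'` shifts the prescribed parities by `U'`.
  hom-⊕ : ∀ {U U' U''} F f ζ → (∀ v → U v xor U' v ≡ U'' v) →
          IsHom F (twisted U) f → Lift U' F (base ∘ f) ζ → IsHom F (twisted U'') (λ x → f x ⊕ ζ x)
  hom-⊕ {U} {U'} {U''} F f ζ eq h l = Lift⇒hom-point U'' F (base ∘ f) _ (hom-base U F f h) λ x y a →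
    let (d , e) = hom⇒Lift U F f h x y a ; (d' , e') = l x y a in
    trans (degree-xor (base (f x)) (label (f x)) (ζ x)) (trans (cong₂ _xor_ d d') (eq (base (f x))))
    , λ uv → cong₂ _xor_ (e uv) (e' uv)

  module _ (U : V G → Bool) (F : Graph) where

    private
      0̂ : V G → Bool
      0̂ _ = false

      Over : Vec (V G) (size F) → (V F → Point) → Set
      Over φ f = ∀ x → base (f x) ≡ Vec.lookup φ x

      over? : ∀ φ → Dec (Any (Over φ) (homs F (twisted U)))
      over? φ = Any.any? (λ f → all? (λ x → base (f x) ≟ Vec.lookup φ x)) (homs F (twisted U))

      -- φ is stored as a vector so that pointwise equal maps get the same lift.
      chosen : Vec (V G) (size F) → V F → V G → Bool
      chosen φ with over? φ
      ... | yes o = label ∘ proj₁ (find o)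
      ... | no  _ = λ _ _ → false

      chosen-Lift : ∀ φ f → IsHom F (twisted U) f → base ∘ f ≗ φ → Lift U F φ (chosen (tabulate φ))
      chosen-Lift φ f h b with over? (tabulate φ)
      ... | yes o = let (g , g∈ , bg) = find o in
        Lift-resp-≗ {U} {F} (λ x → trans (bg x) (lookup∘tabulate φ x))
          (hom⇒Lift U F g (All.lookup (all-homs F (twisted U)) g∈))
      ... | no ¬o = contradiction
        (Any.map (λ f≗g x → trans (cong base (≡-sym (f≗g x))) (trans (b x) (≡-sym (lookup∘tabulate φ x))))
            (IsHom⇒∈homs F (twisted U) h)) ¬o

      -- It keeps the base map and is translation by a constant on each fibre, hence injective. As
      -- `U` is its own inverse under `xor`, the same map serves in both directions between the two
      -- twisted graphs.
      translate : (V F → Point) → V F → Point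
      translate f x = f x ⊕ chosen (tabulate (base ∘ f)) x

      translate-injective : ∀ {f g} → translate f ≗ translate g → f ≗ g
      translate-injective {f} {g} eq x = ⊕-cancel (b x) (λ v → cong (λ φ → chosen φ x v) (tabulate-cong b)) (eq x)
        where
        b : base ∘ f ≗ base ∘ g
        b y = trans (≡-sym (base-point _ _)) (trans (cong base (eq y)) (base-point _ _))

      translate-hom : ∀ f → IsHom F (twisted U) f → IsHom F (twisted 0̂) (translate f)
      translate-hom f h = hom-⊕ {U} {U} {0̂} F f _ (λ v → xor-same (U v)) h (chosen-Lift _ f h (λ _ → refl))

    hom-twisted-≤ : hom F (twisted U) ≤ hom F (twisted 0̂)
    hom-twisted-≤ = hom-mono-≤ F {twisted U} {twisted 0̂} translate translate-hom translate-injective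

    hom-twisted-≥ : (∀ φ → IsHom F G φ → Σ _ (Lift U F φ)) → hom F (twisted 0̂) ≤ hom F (twisted U)
    hom-twisted-≥ lift = hom-mono-≤ F {twisted 0̂} {twisted U} translate back translate-injective
      where
      back : ∀ f → IsHom F (twisted 0̂) f → IsHom F (twisted U) (translate f)
      back f h = hom-⊕ {0̂} {U} {U} F f _ (λ _ → refl) h
        -- The given lift only shows that some homomorphism lies over `base ∘ f`; the translation
        -- uses the chosen one.
        (chosen-Lift (base ∘ f) _ (Lift⇒hom-point U F _ (proj₁ l) (hom-base 0̂ F f h) (proj₂ l))
            (λ x → base-point _ _))
        where l = lift (base ∘ f) (hom-base 0̂ F f h)

    -- The zero labels over `φ` give a homomorphism to `twisted 0̂` that `translate` misses: a
    -- preimage would have the same base `φ` and so be a lift of it.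
    hom-twisted-< : ∀ φ → IsHom F G φ → ¬ (Σ _ (Lift U F φ)) → hom F (twisted U) < hom F (twisted 0̂)
    hom-twisted-< φ h ¬lift = hom-mono-< F {twisted U} {twisted 0̂} translate translate-hom translate-injective
      _ (Lift⇒hom-point 0̂ F φ (λ _ _ → false) h (λ x y a → degree-0 (φ x) , λ _ → refl))
      λ f f-hom eq → ¬lift (label ∘ f , Lift-resp-≗ {U} {F}
        (λ x → trans (≡-sym (base-point _ _)) (trans (cong base (≡-sym (eq x))) (base-point _ _)))
        (hom⇒Lift U F f f-hom))

-- Separations of order at most one

∣p∣≤1⇒x≡y : ∀ {n} {p : Subset n} {x y} → ∣ p ∣ ≤ 1 → x ∈ p → y ∈ p → x ≡ y
∣p∣≤1⇒x≡y {p = p} {x} {y} p≤1 x∈p y∈p = decidable-stable (x ≟ y) λ x≢y →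
  <⇒≱ (p⊂q⇒∣p∣<∣q∣ {p = ⁅ x ⁆} {p}
      ((λ z∈ → subst (_∈ p) (≡-sym (x∈⁅y⁆⇒x≡y x z∈)) x∈p) , y , y∈p , λ y∈ → x≢y (≡-sym (x∈⁅y⁆⇒x≡y x y∈))))
    (≤-trans p≤1 (≤-reflexive (≡-sym (∣⁅x⁆∣≡1 x))))

∣p∪q∣≤∣p∣+∣q∣ : ∀ {n} (p q : Subset n) → ∣ p ∪ q ∣ ≤ ∣ p ∣ + ∣ q ∣
∣p∪q∣≤∣p∣+∣q∣ []            []            = z≤n
∣p∪q∣≤∣p∣+∣q∣ (outside ∷ p) (outside ∷ q) = ∣p∪q∣≤∣p∣+∣q∣ p q
∣p∪q∣≤∣p∣+∣q∣ (outside ∷ p) (inside ∷ q)  =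
  ≤-trans (s≤s (∣p∪q∣≤∣p∣+∣q∣ p q)) (≤-reflexive (≡-sym (+-suc ∣ p ∣ ∣ q ∣)))
∣p∪q∣≤∣p∣+∣q∣ (inside ∷ p)  (outside ∷ q) = s≤s (∣p∪q∣≤∣p∣+∣q∣ p q)
∣p∪q∣≤∣p∣+∣q∣ (inside ∷ p)  (inside ∷ q)  = s≤s (≤-trans (∣p∪q∣≤∣p∣+∣q∣ p q) (+-monoʳ-≤ ∣ p ∣ (n≤1+n ∣ q ∣)))

-- Induction on the domain: when `zero` is in `p`, its value is removed from `q`, which costs at
-- most one element.
∣image∣≤∣p∣ : ∀ {m n} (p : Subset m) (f : Fin m → Fin n) (q : Subset n) →
             (∀ {y} → y ∈ q → ∃ λ x → x ∈ p × f x ≡ y) → ∣ q ∣ ≤ ∣ p ∣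
∣image∣≤∣p∣ {n = n} [] f q onto =
  ≤-reflexive (trans (cong ∣_∣ (Empty-unique {p = q} λ (_ , y∈q) → case₀ (onto y∈q))) (∣⊥∣≡0 n))
  where
  case₀ : ∀ {y} → ¬ (∃ λ x → x ∈ [] × f x ≡ y)
  case₀ (() , _)
∣image∣≤∣p∣ (outside ∷ p) f q onto = ∣image∣≤∣p∣ p (f ∘ suc) q λ y∈q → shift (onto y∈q)
  where
  shift : ∀ {y} → (∃ λ x → x ∈ (outside ∷ p) × f x ≡ y) → ∃ λ x → x ∈ p × f (suc x) ≡ y
  shift (suc x , there x∈p , eq) = x , x∈p , eq
∣image∣≤∣p∣ (inside ∷ p) f q onto = ≤-trans (p⊆q⇒∣p∣≤∣q∣ split)
  (≤-trans (∣p∪q∣≤∣p∣+∣q∣ ⁅ f zero ⁆ q')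
    (+-mono-≤ (≤-reflexive (∣⁅x⁆∣≡1 (f zero)))
        (∣image∣≤∣p∣ p (f ∘ suc) q' λ y∈q' → let (y∈q , y∈) = x∈p∩q⁻ q (∁ ⁅ f zero ⁆) y∈q'
                                      in shift (x∈∁p⇒x∉p y∈) (onto y∈q))))
  where
  q' = q ∩ ∁ ⁅ f zero ⁆
  split : q ⊆ ⁅ f zero ⁆ ∪ q'
  split {y} y∈q with y ∈? ⁅ f zero ⁆
  ... | yes y∈ = x∈p∪q⁺ (inj₁ y∈)
  ... | no  y∉ = x∈p∪q⁺ (inj₂ (x∈p∩q⁺ (y∈q , x∉p⇒x∈∁p y∉)))
  shift : ∀ {y} → y ∉ ⁅ f zero ⁆ → (∃ λ x → x ∈ (inside ∷ p) × f x ≡ y) → ∃ λ x → x ∈ p × f (suc x) ≡ y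
  shift y∉ (zero  , _         , refl) = contradiction (x∈⁅x⁆ (f zero)) y∉
  shift y∉ (suc x , there x∈p , eq)   = x , x∈p , eq

-- Pigeonhole principle: the search is decidable, and its failure would make the image of `p` cover
-- `q`.
∃-outside-image : ∀ {m n} (p : Subset m) (f : Fin m → Fin n) (q : Subset n) → ∣ p ∣ < ∣ q ∣ →
                  ∃ λ y → y ∈ q × (∀ x → x ∈ p → f x ≢ y)
∃-outside-image p f q p<q with any? (λ y → (y ∈? q) ×-dec all? (λ x → (x ∈? p) →-dec ¬? (f x ≟ y)))
... | yes found = found
... | no  none  = contradiction (∣image∣≤∣p∣ p f q onto) (<⇒≱ p<q)
  where
  onto : ∀ {y} → y ∈ q → ∃ λ x → x ∈ p × f x ≡ y
  onto {y} y∈q = decidable-stable (any? (λ x → (x ∈? p) ×-dec (f x ≟ y)))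
    λ ¬∃ → none (y , y∈q , λ x x∈p eq → ¬∃ (x , x∈p , eq))

x∉p⇒p⊂p∪⁅x⁆ : ∀ {n} {p : Subset n} {x} → x ∉ p → p ⊂ p ∪ ⁅ x ⁆
x∉p⇒p⊂p∪⁅x⁆ {p = p} {x} x∉p = p⊆p∪q ⁅ x ⁆ , x , x∈p∪q⁺ (inj₂ (x∈⁅x⁆ x)) , x∉p

-- Induction by adding one element at a time. The missing element `s` only shows that `R` is not
-- everything; the step chooses which `y` to add.
⊃-growth : ∀ {n} (P : Subset n → Set) → (∀ R → P R → ∀ s → s ∉ R → ∃ λ y → y ∉ R × P (R ∪ ⁅ y ⁆)) →
           ∀ R → P R → P ⊤
⊃-growth P grow R = go R (⊃-wellFounded R)
  where
  go : ∀ R → Acc _⊃_ R → P R → P ⊤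
  go R (acc rec) PR with nonempty? (∁ R)
  ... | yes (s , s∈∁R) = let (y , y∉R , PR') = grow R PR s (x∈∁p⇒x∉p s∈∁R) in
                         go (R ∪ ⁅ y ⁆) (rec (x∉p⇒p⊂p∪⁅x⁆ y∉R)) PR'
  ... | no  empty      = subst P (⊆-antisym ⊆⊤ (λ {x} _ → x∉∁p⇒x∈p (λ x∈∁R → empty (x , x∈∁R)))) PR

-- Both sides are proper subsets, so recursion into them terminates. The last condition says that an
-- edge between the sides lies within one of them.
Separates : (G : Graph) → Subset (size G) → Subset (size G) → Subset (size G) → Set
Separates G W A B = (A ⊂ W × B ⊂ W × W ⊆ A ∪ B) × ∣ A ∩ B ∣ ≤ 1
  × (∀ u v → u ∈ A → v ∈ B → Adj G u v → u ∈ B ⊎ v ∈ A)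

Separable : (G : Graph) → Subset (size G) → Set
Separable G W = ∃ λ A → ∃ λ B → Separates G W A B

separable? : ∀ G W → Dec (Separable G W)
separable? G W = anySubset? λ A → anySubset? λ B →
  ((A ⊂? W) ×-dec (B ⊂? W) ×-dec (W ⊆? A ∪ B)) ×-dec (∣ A ∩ B ∣ ≤? 1)
  ×-dec all? (λ u → all? (λ v → (u ∈? A) →-dec (v ∈? B) →-dec (adj G u v ≟ᵇ true) →-dec ((u ∈? B) ⊎-dec (v ∈? A))))

-- Sums over the two-element field

δ : ∀ {n} → Fin n → Fin n → Bool
δ i j = does (i ≟ j)

δ-sym : ∀ {n} (i j : Fin n) → δ i j ≡ δ j i
δ-sym i j with i ≟ j
... | yes refl = ≡-sym (dec-true (i ≟ i) refl)
... | no  i≢j  = ≡-sym (dec-false (j ≟ i) (i≢j ∘ ≡-sym))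

sum-δ : ∀ {n} (c : Fin n → Bool) j → sum (λ i → c i ∧ δ i j) ≡ c j
sum-δ {suc n} c zero = begin
  (c zero ∧ true) xor sum (λ i → c (suc i) ∧ false)
    ≡⟨ cong₂ _xor_ (∧-comm (c zero) true) (trans (sum-cong-≗ (λ i → ∧-zeroʳ (c (suc i)))) (sum-replicate-zero n)) ⟩
  c zero xor false ≡⟨ xor-identityʳ (c zero) ⟩
  c zero           ∎
  where open ≡-Reasoning
sum-δ {suc n} c (suc j) =
  trans (cong (_xor sum (λ i → c (suc i) ∧ δ (suc i) (suc j))) (∧-zeroʳ (c zero))) (sum-δ (c ∘ suc) j)

-- Over 𝔽₂ the off-diagonal entries of a symmetric matrix cancel in pairs.
sum-symmetric : ∀ {n} (h : Fin n → Fin n → Bool) → (∀ i j → h i j ≡ h j i) → (∀ i → h i i ≡ false) →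
                sum (λ i → sum (h i)) ≡ false
sum-symmetric {zero}  h h-sym h-diag = refl
sum-symmetric {suc n} h h-sym h-diag = begin
  (h zero zero xor r) xor sum (λ i → h (suc i) zero xor sum (h (suc i) ∘ suc))
    ≡⟨ cong₂ _xor_ (cong (_xor r) (h-diag zero)) (∑-distrib-+ (λ i → h (suc i) zero) (λ i → sum (h (suc i) ∘ suc))) ⟩
  r xor (sum (λ i → h (suc i) zero) xor sum (λ i → sum (h (suc i) ∘ suc)))
    ≡⟨ cong₂ (λ a b → r xor (a xor b)) (sum-cong-≗ (λ i → h-sym (suc i) zero))
         (sum-symmetric (λ i j → h (suc i) (suc j)) (λ i j → h-sym (suc i) (suc j)) (λ i → h-diag (suc i))) ⟩
  r xor (r xor false) ≡⟨ cong (r xor_) (xor-identityʳ r) ⟩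
  r xor r             ≡⟨ xor-same r ⟩
  false               ∎
  where
  open ≡-Reasoning
  r = sum (h zero ∘ suc)

-- Growing a tree decomposition

module _ {G : Graph} where

  mapWalk : ∀ {P Q : V G → Set} {u v} → (∀ {x} → P x → Q x) → WalkIn G P u v → WalkIn G Q u v
  mapWalk f (here p)     = here (f p)
  mapWalk f (step p a w) = step (f p) a (mapWalk f w)

  infixr 5 _++ʷ_
  _++ʷ_ : ∀ {P : V G → Set} {u v w} → WalkIn G P u v → WalkIn G P v w → WalkIn G P u w
  here _     ++ʷ r = r
  step p a q ++ʷ r = step p a (q ++ʷ r)

  -- The encoding follows `Cycle`, so that prefixing one vertex to a path can close it to a cycle.
  record Path (P : V G → Set) (u v : V G) : Set where
    field
      len   : ℕ
      vs    : Fin (suc len) → V G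
      inj   : ∀ i j → vs i ≡ vs j → i ≡ j
      edges : ∀ (i : Fin len) → Adj G (vs (inject₁ i)) (vs (suc i))
      all   : ∀ i → P (vs i)
      start : vs zero ≡ u
      end   : vs (fromℕ len) ≡ v
  open Path

  suffix : ∀ {P u v} (p : Path P u v) i → Path P (vs p i) v
  suffix p zero = record { Path p ; start = refl }
  suffix p@record { len = suc m } (suc i) = suffix tail i
    where
    tail : Path _ (vs p (suc zero)) _
    tail = record
      { len   = m
      ; vs    = vs p ∘ suc
      ; inj   = λ i j eq → suc-injective (inj p (suc i) (suc j) eq)
      ; edges = edges p ∘ suc
      ; all   = all p ∘ suc
      ; start = refl
      ; end   = end p
      }

  consPath : ∀ {P u w v} → P u → Adj G u w → (p : Path P w v) → (∀ i → vs p i ≢ u) → Path P u v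
  consPath {u = u} pu a p fresh = record
    { len   = suc (len p)
    ; vs    = u VF.∷ vs p
    ; inj   = λ { zero zero _ → refl
                ; zero (suc j) eq → contradiction (≡-sym eq) (fresh j)
                ; (suc i) zero eq → contradiction eq (fresh i)
                ; (suc i) (suc j) eq → cong suc (inj p i j eq) }
    ; edges = λ { zero → subst (Adj G u) (≡-sym (start p)) a ; (suc i) → edges p i }
    ; all   = λ { zero → pu ; (suc i) → all p i }
    ; start = refl
    ; end   = end p
    }

  -- Loop erasure: if the new first vertex already lies on the path, everything before that
  -- occurrence is cut off.
  walk⇒path : ∀ {P u v} → WalkIn G P u v → Path P u v
  walk⇒path {v = v} (here p) = record
    { len = 0 ; vs = λ _ → v ; inj = λ { zero zero _ → refl } ; edges = λ ()
    ; all = λ _ → p ; start = refl ; end = refl }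
  walk⇒path {P} {u} {v} (step p a q) with walk⇒path q
  ... | r with any? (λ i → vs r i ≟ u)
  ... | yes (i , eq) = subst (λ x → Path P x v) eq (suffix r i)
  ... | no  fresh    = consPath p a r λ i eq → fresh (i , eq)

  -- A path of positive length from `x` to `x'` avoiding `y` would close through `y` to a cycle on
  -- at least three vertices.
  acyclic⇒unique-neighbour : ¬ Cycle G → ∀ {y x x'} → Adj G y x → Adj G y x' → WalkIn G (_≢ y) x x' → x ≡ x'
  acyclic⇒unique-neighbour acyclic {y} {x} {x'} yx yx' walk with walk⇒path walk
  ... | p@record { len = zero }  = trans (≡-sym (start p)) (end p)
  ... | p@record { len = suc m } = contradiction cycle acyclic
    where
    cycle : Cycle G
    cycle = record
      { m     = m
      ; vs    = y VF.∷ vs p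
      ; inj   = λ { zero zero _ → refl
                  ; zero (suc j) eq → contradiction (≡-sym eq) (all p j)
                  ; (suc i) zero eq → contradiction eq (all p i)
                  ; (suc i) (suc j) eq → cong suc (inj p i j eq) }
      ; edges = λ { zero → subst (Adj G y) (≡-sym (start p)) yx ; (suc i) → edges p i }
      ; close = trans (sym G _ y) (subst (Adj G y) (≡-sym (end p)) yx')
      }

  -- The walk is cut at its first arrival at `y`; `x` is the vertex just before.
  before-arrival : ∀ {P s y} → WalkIn G P s y → s ≢ y → ∃ λ x → P x × Adj G y x × WalkIn G (_≢ y) s x
  before-arrival (here _) s≢y = contradiction refl s≢y
  before-arrival {P} {s} {y} (step {w = w} p a q) s≢y with w ≟ y
  ... | yes refl = s , p , trans (sym G w s) a , here s≢y
  ... | no  w≢y  = let (x , px , yx , r) = before-arrival q w≢y in x , px , yx , step s≢y a r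

  exit-edge : ∀ {P r s} (R : Subset (size G)) → WalkIn G P r s → r ∈ R → s ∉ R → ∃ λ x → ∃ λ y →
    x ∈ R × y ∉ R × Adj G x y
  exit-edge R (here _) r∈R r∉R = contradiction r∈R r∉R
  exit-edge {r = r} R (step {w = w} _ a q) r∈R s∉R with w ∈? R
  ... | yes w∈R = exit-edge R q w∈R s∉R
  ... | no  w∉R = r , w , r∈R , w∉R , a

Covered : ∀ {F} (D : TreeDecomposition F) → Subset (size (T D)) → V F → Set
Covered D R x = ∃ λ s → s ∈ R × x ∈ bag D s

module _ {F : Graph} (D : TreeDecomposition F) (adhesion : AdhesionAtMost 1 D) where

  -- Induction over a growing connected set `R` of tree nodes. A new node `y` is attached to `R`
  -- through one neighbour `x`, and the vertices of its bag that are already covered all lie in the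
  -- bag of `x`, so adhesion 1 leaves at most one of them.
  tree-growth : (Q : Subset (size (T D)) → Set) → Q ⊥ →
    (∀ R y → (∀ u v → u ∈ bag D y → v ∈ bag D y → Covered D R u → Covered D R v → u ≡ v) → Q R → Q (R ∪ ⁅ y ⁆)) →
    Q ⊤
  tree-growth Q Q⊥ Q-step = proj₂ (⊃-growth P grow ⊥ ((λ s t s∈⊥ → contradiction s∈⊥ ∉⊥) , Q⊥))
    where
    Linked : Subset (size (T D)) → Set
    Linked R = ∀ s t → s ∈ R → t ∈ R → WalkIn (T D) (_∈ R) s t

    P : Subset (size (T D)) → Set
    P R = Linked R × Q R

    module _ {R : Subset (size (T D))} {x y : V (T D)} (linked : Linked R) (x∈R : x ∈ R) (y∉R : y ∉ R) (xy : Adj (T D) x y) where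

      private
        yx : Adj (T D) y x
        yx = trans (sym (T D) y x) xy

        wide : ∀ {s t} → WalkIn (T D) (_∈ R) s t → WalkIn (T D) (_∈ R ∪ ⁅ y ⁆) s t
        wide = mapWalk (λ s∈R → x∈p∪q⁺ (inj₁ s∈R))

        y∈ : y ∈ R ∪ ⁅ y ⁆
        y∈ = x∈p∪q⁺ (inj₂ (x∈⁅x⁆ y))

      linked-∪ : Linked (R ∪ ⁅ y ⁆)
      linked-∪ s t s∈ t∈ with x∈p∪q⁻ R ⁅ y ⁆ s∈ | x∈p∪q⁻ R ⁅ y ⁆ t∈
      ... | inj₁ s∈R | inj₁ t∈R = wide (linked s t s∈R t∈R)
      ... | inj₁ s∈R | inj₂ t∈y with refl ← x∈⁅y⁆⇒x≡y y t∈y =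
        wide (linked s x s∈R x∈R) ++ʷ step (x∈p∪q⁺ (inj₁ x∈R)) xy (here y∈)
      ... | inj₂ s∈y | inj₁ t∈R with refl ← x∈⁅y⁆⇒x≡y y s∈y = step y∈ yx (wide (linked x t x∈R t∈R))
      ... | inj₂ s∈y | inj₂ t∈y with refl ← x∈⁅y⁆⇒x≡y y s∈y | refl ← x∈⁅y⁆⇒x≡y y t∈y = here y∈

      -- The walk through the bags containing `u` from `s` to `y` enters `y` from some `x'`. As `x`
      -- and `x'` are joined through `s` without meeting `y`, acyclicity forces `x'` to be `x`.
      covered⇒∈bag : ∀ {u} → u ∈ bag D y → Covered D R u → u ∈ bag D x
      covered⇒∈bag {u} u∈y (s , s∈R , u∈s) with before-arrival (subtree D u s y u∈s u∈y) (λ { refl → y∉R s∈R })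
      ... | x' , u∈x' , yx' , s⇝x' = subst (λ z → u ∈ bag D z) (≡-sym x≡x') u∈x'
        where
        x≡x' : x ≡ x'
        x≡x' = acyclic⇒unique-neighbour (proj₂ (isTree D)) yx yx'
            (mapWalk (λ { z∈R refl → y∉R z∈R }) (linked x s x∈R s∈R) ++ʷ s⇝x')

    grow : ∀ R → P R → ∀ s → s ∉ R → ∃ λ y → y ∉ R × P (R ∪ ⁅ y ⁆)
    grow R (linked , q) s s∉R with nonempty? R
    ... | no  empty     = s , s∉R , alone , Q-step R s (λ u v _ _ (r , r∈R , _) _ → contradiction (r , r∈R) empty) q
      where
      only-s : ∀ {t} → t ∈ R ∪ ⁅ s ⁆ → t ≡ s
      only-s t∈ with x∈p∪q⁻ R ⁅ s ⁆ t∈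
      ... | inj₁ t∈R = contradiction (_ , t∈R) empty
      ... | inj₂ t∈s = x∈⁅y⁆⇒x≡y s t∈s
      alone : Linked (R ∪ ⁅ s ⁆)
      alone t t' t∈ t'∈ with refl ← only-s t∈ | refl ← only-s t'∈ = here t∈
    ... | yes (r , r∈R) with exit-edge R (proj₁ (isTree D) r s) r∈R s∉R
    ... | x , y , x∈R , y∉R , xy = y , y∉R , linked-∪ linked x∈R y∉R xy , Q-step R y
      (λ u v u∈y v∈y u∈R v∈R → ∣p∣≤1⇒x≡y (adhesion x y xy)
        (x∈p∩q⁺ (covered⇒∈bag linked x∈R y∉R xy u∈y u∈R , u∈y))
            (x∈p∩q⁺ (covered⇒∈bag linked x∈R y∉R xy v∈y v∈R , v∈y))) q

-- Lifting to twisted graphs over an inseparable set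

module Inseparable (G : Graph) (W : Subset (size G)) (W-insep : ¬ Separable G W) where

  open Twist G W

  module _ (X : Subset (size G)) (X≤1 : ∣ X ∣ ≤ 1) {w : V G} (w∈W : w ∈ W) (w∉X : w ∉ X) where

    -- Connectivity of `W` minus `X`, stated as induction along edges; `Good` is a family of sets so
    -- that it can also carry data such as a path.
    connected : (Good : V G → Set) → Good w →
                (∀ x y → x ∉ X → y ∉ X → E x y → Good x → Good y) →
                ∀ u → u ∈ W → u ∉ X → Good u
    connected Good good-w good-step u = proj₂ (⊃-growth P grow ⁅ w ⁆ start) u ∈⊤
      where
      P : Subset (size G) → Set
      P R = w ∈ R × (∀ u → u ∈ R → u ∈ W → u ∉ X → Good u)

      start : P ⁅ w ⁆
      start = x∈⁅x⁆ w , λ u u∈ _ _ → subst Good (≡-sym (x∈⁅y⁆⇒x≡y w u∈)) good-w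

      add : ∀ {R} y → P R → (y ∈ W → y ∉ X → Good y) → P (R ∪ ⁅ y ⁆)
      add {R} y (w∈R , good) good-y = x∈p∪q⁺ (inj₁ w∈R) , λ u u∈ u∈W u∉X → extend u (x∈p∪q⁻ R ⁅ y ⁆ u∈) u∈W u∉X
        where
        extend : ∀ u → u ∈ R ⊎ u ∈ ⁅ y ⁆ → u ∈ W → u ∉ X → Good u
        extend u (inj₁ u∈R) u∈W u∉X = good u u∈R u∈W u∉X
        extend u (inj₂ u∈y) u∈W u∉X with refl ← x∈⁅y⁆⇒x≡y y u∈y = good-y u∈W u∉X

      grow : ∀ R → P R → ∀ s → s ∉ R → ∃ λ y → y ∉ R × P (R ∪ ⁅ y ⁆)
      grow R PR@(w∈R , good) s s∉R with s ∈? W | s ∈? X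
      -- Vertices outside `W` or inside `X` enter `R` freely, as nothing is claimed about them.
      ... | no s∉W  | _       = s , s∉R , add s PR λ s∈W _ → contradiction s∈W s∉W
      ... | yes _   | yes s∈X = s , s∉R , add s PR λ _ s∉X → contradiction s∈X s∉X
      ... | yes s∈W | no s∉X
        with any? (λ x → any? (λ y → ((x ∈? R) ×-dec ¬? (x ∈? X)) ×-dec (¬? (y ∈? R) ×-dec ¬? (y ∈? X)) ×-dec E? x y))
      ... | yes (x , y , (x∈R , x∉X) , (y∉R , y∉X) , e@(_ , x∈W , _)) =
        y , y∉R , add y PR λ _ _ → good-step x y x∉X y∉X e (good x x∈R x∈W x∉X)
      -- No edge of `W` leaves `R` away from `X`, so `R` and its complement, both enlarged by `X`,
      -- separate `W`. The first side misses `s` and the second misses `w`.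
      ... | no none = ⊥-elim (W-insep (W ∩ (R ∪ X) , W ∩ (∁ R ∪ X) , (A⊂W , B⊂W , W⊆A∪B) , A∩B≤1 , no-edge))
        where
        A⊂W : W ∩ (R ∪ X) ⊂ W
        A⊂W = p∩q⊆p W (R ∪ X) , s , s∈W , λ s∈A → ∉-both (x∈p∪q⁻ R X (proj₂ (x∈p∩q⁻ W (R ∪ X) s∈A)))
          where
          ∉-both : ¬ (s ∈ R ⊎ s ∈ X)
          ∉-both (inj₁ s∈R) = s∉R s∈R
          ∉-both (inj₂ s∈X) = s∉X s∈X
        B⊂W : W ∩ (∁ R ∪ X) ⊂ W
        B⊂W = p∩q⊆p W (∁ R ∪ X) , w , w∈W , λ w∈B → ∉-both (x∈p∪q⁻ (∁ R) X (proj₂ (x∈p∩q⁻ W (∁ R ∪ X) w∈B)))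
          where
          ∉-both : ¬ (w ∈ ∁ R ⊎ w ∈ X)
          ∉-both (inj₁ w∈∁R) = x∈∁p⇒x∉p w∈∁R w∈R
          ∉-both (inj₂ w∈X)  = w∉X w∈X
        W⊆A∪B : W ⊆ W ∩ (R ∪ X) ∪ W ∩ (∁ R ∪ X)
        W⊆A∪B {u} u∈W with u ∈? R
        ... | yes u∈R = x∈p∪q⁺ (inj₁ (x∈p∩q⁺ (u∈W , x∈p∪q⁺ (inj₁ u∈R))))
        ... | no  u∉R = x∈p∪q⁺ (inj₂ (x∈p∩q⁺ (u∈W , x∈p∪q⁺ (inj₁ (x∉p⇒x∈∁p u∉R)))))
        A∩B⊆X : (W ∩ (R ∪ X)) ∩ (W ∩ (∁ R ∪ X)) ⊆ X
        A∩B⊆X u∈ with x∈p∩q⁻ (W ∩ (R ∪ X)) (W ∩ (∁ R ∪ X)) u∈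
        ... | u∈A , u∈B with x∈p∪q⁻ R X (proj₂ (x∈p∩q⁻ W (R ∪ X) u∈A))
                           | x∈p∪q⁻ (∁ R) X (proj₂ (x∈p∩q⁻ W (∁ R ∪ X) u∈B))
        ... | inj₂ u∈X | _         = u∈X
        ... | inj₁ _   | inj₂ u∈X  = u∈X
        ... | inj₁ u∈R | inj₁ u∈∁R = contradiction u∈R (x∈∁p⇒x∉p u∈∁R)
        A∩B≤1 : ∣ (W ∩ (R ∪ X)) ∩ (W ∩ (∁ R ∪ X)) ∣ ≤ 1
        A∩B≤1 = ≤-trans (p⊆q⇒∣p∣≤∣q∣ A∩B⊆X) X≤1
        no-edge : ∀ u v → u ∈ W ∩ (R ∪ X) → v ∈ W ∩ (∁ R ∪ X) → Adj G u v → u ∈ W ∩ (∁ R ∪ X) ⊎ v ∈ W ∩ (R ∪ X)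
        no-edge u v u∈A v∈B a with x∈p∩q⁻ W (R ∪ X) u∈A | x∈p∩q⁻ W (∁ R ∪ X) v∈B
        ... | u∈W , u∈R∪X | v∈W , v∈∁R∪X with u ∈? X | v ∈? X
        ... | yes u∈X | _       = inj₁ (x∈p∩q⁺ (u∈W , x∈p∪q⁺ (inj₂ u∈X)))
        ... | no _    | yes v∈X = inj₂ (x∈p∩q⁺ (v∈W , x∈p∪q⁺ (inj₂ v∈X)))
        ... | no u∉X  | no v∉X with x∈p∪q⁻ R X u∈R∪X | x∈p∪q⁻ (∁ R) X v∈∁R∪X
        ... | inj₂ u∈X | _         = contradiction u∈X u∉X
        ... | inj₁ _   | inj₂ v∈X  = contradiction v∈X v∉X
        ... | inj₁ u∈R | inj₁ v∈∁R = contradiction (u , v , (u∈R , u∉X) , (x∈∁p⇒x∉p v∈∁R , v∉X) , a , u∈W , v∈W) none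

  -- Edge sets with prescribed degree parities

  degree-∧ : ∀ t c S → degree t (λ u → c ∧ S u) ≡ c ∧ degree t S
  degree-∧ t false S = degree-0 t
  degree-∧ t true  S = refl

  degree-δ : ∀ t y → degree t (λ u → δ u y) ≡ does (E? t y)
  degree-δ t y = sum-δ (λ u → does (E? t u)) y

  degree-sum : ∀ t {n} (h : Fin n → V G → Bool) → degree t (λ v → sum (λ u → h u v)) ≡ sum (λ u → degree t (h u))
  degree-sum t h = trans (sum-cong-≗ (λ v → *-distribˡ-sum (does (E? t v)) (λ u → h u v)))
    (∑-comm (λ v u → does (E? t v) ∧ h u v))

  degree-∉ : ∀ {t} S → t ∉ W → degree t S ≡ false
  degree-∉ {t} S t∉W =
    trans (degree-cong t {S} {λ _ → false} (λ _ (_ , t∈W , _) → contradiction t∈W t∉W)) (degree-0 t)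

  module _ (X : Subset (size G)) (X≤1 : ∣ X ∣ ≤ 1) {w : V G} (w∈W : w ∈ W) (w∉X : w ∉ X) where

    -- The edges of a walk from `w` to `u` counted modulo 2, as a symmetric matrix that vanishes on
    -- the rows of `X`. The parity at `w` is left free: defects are absorbed there.
    record PathTo (u : V G) : Set where
      field
        edge      : V G → V G → Bool
        edge-sym  : ∀ s t → edge s t ≡ edge t s
        edge-X    : ∀ s t → s ∈ X → edge s t ≡ false
        endpoints : ∀ t → t ≢ w → degree t (edge t) ≡ δ t u
    open PathTo

    ∅-path : PathTo w
    ∅-path = record
      { edge      = λ _ _ → false
      ; edge-sym  = λ _ _ → refl
      ; edge-X    = λ _ _ _ → refl
      ; endpoints = λ t t≢w → trans (degree-0 t) (≡-sym (dec-false (t ≟ w) t≢w))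
      }

    -- Toggling the edge between `x` and `y` moves the odd end from `x` to `y`.
    extend-path : ∀ x y → x ∉ X → y ∉ X → E x y → PathTo x → PathTo y
    extend-path x y x∉X y∉X xy p = record
      { edge      = λ s t → edge p s t xor ((δ s x ∧ δ t y) xor (δ s y ∧ δ t x))
      ; edge-sym  = λ s t → cong₂ _xor_ (edge-sym p s t)
          (trans (xor-comm (δ s x ∧ δ t y) _) (cong₂ _xor_ (∧-comm (δ s y) (δ t x)) (∧-comm (δ s x) (δ t y))))
      ; edge-X    = λ s t s∈X → cong₂ _xor_ (edge-X p s t s∈X)
          (cong₂ (λ a b → (a ∧ δ t y) xor (b ∧ δ t x)) (dec-false (s ≟ x) (λ s≡x → x∉X (subst (_∈ X) s≡x s∈X)))
            (dec-false (s ≟ y) (λ s≡y → y∉X (subst (_∈ X) s≡y s∈X))))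
      ; endpoints = λ t t≢w → begin
          degree t (λ u → edge p t u xor ((δ t x ∧ δ u y) xor (δ t y ∧ δ u x)))
            ≡⟨ trans (degree-xor t _ _) (cong (degree t (edge p t) xor_) (degree-xor t _ _)) ⟩
          degree t (edge p t) xor (degree t (λ u → δ t x ∧ δ u y) xor degree t (λ u → δ t y ∧ δ u x))
            ≡⟨ cong₂ _xor_ (endpoints p t t≢w) (cong₂ _xor_ (half t x y xy) (half t y x (E-sym xy))) ⟩
          δ t x xor (δ t x xor δ t y)
            ≡⟨ xor-assoc (δ t x) (δ t x) (δ t y) ⟨
          (δ t x xor δ t x) xor δ t y
            ≡⟨ cong (_xor δ t y) (xor-same (δ t x)) ⟩
          δ t y ∎
      }
      where
      open ≡-Reasoning
      half : ∀ t x y → E x y → degree t (λ u → δ t x ∧ δ u y) ≡ δ t x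
      half t x y xy = begin
        degree t (λ u → δ t x ∧ δ u y) ≡⟨ degree-∧ t (δ t x) (λ u → δ u y) ⟩
        δ t x ∧ degree t (λ u → δ u y)
          ≡⟨ does-∧-cong (t ≟ x) (λ t≡x → trans (degree-δ t y) (dec-true (E? t y) (subst (λ s → E s y) (≡-sym t≡x) xy))) ⟩
        δ t x ∧ true                   ≡⟨ ∧-comm (δ t x) true ⟩
        δ t x                          ∎

    -- Sum the paths to w from all vertices where f is odd.
    T-join : (f : V G → Bool) → Σ (V G → V G → Bool) λ Z → (∀ s t → Z s t ≡ Z t s)
         × (∀ s t → s ∈ X → Z s t ≡ false) × (∀ t → t ∈ W → t ∉ X → t ≢ w → degree t (Z t) ≡ f t)
    T-join f = (λ s t → sum (λ u → f u ∧ path u s t))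
           , (λ s t → sum-cong-≗ (λ u → cong (f u ∧_) (path-sym u s t)))
           , (λ s t s∈X → trans (sum-cong-≗ (λ u → trans (cong (f u ∧_) (path-X u s t s∈X)) (∧-zeroʳ (f u))))
               (sum-replicate-zero (size G)))
           , λ t t∈W t∉X t≢w → trans (degree-sum t (λ u v → f u ∧ path u t v))
               (trans (sum-cong-≗ (λ u → trans (degree-∧ t (f u) (path u t))
                   (cong (f u ∧_) (trans (path-end u t t∈W t∉X t≢w) (δ-sym t u)))))
                 (sum-δ f t))
      where
      path? : ∀ u → Dec (u ∈ W × u ∉ X)
      path? u = (u ∈? W) ×-dec ¬? (u ∈? X)

      pathTo : ∀ u → u ∈ W → u ∉ X → PathTo u
      pathTo = connected X X≤1 w∈W w∉X PathTo ∅-path extend-path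

      path : V G → V G → V G → Bool
      path u with path? u
      ... | yes (u∈W , u∉X) = edge (pathTo u u∈W u∉X)
      -- The zero matrix is correct here, since `path-end` only tests vertices `t` of `W` outside
      -- `X`, and these differ from `u`.
      ... | no  _           = λ _ _ → false

      path-sym : ∀ u s t → path u s t ≡ path u t s
      path-sym u s t with path? u
      ... | yes (u∈W , u∉X) = edge-sym (pathTo u u∈W u∉X) s t
      ... | no  _           = refl

      path-X : ∀ u s t → s ∈ X → path u s t ≡ false
      path-X u s t s∈X with path? u
      ... | yes (u∈W , u∉X) = edge-X (pathTo u u∈W u∉X) s t s∈X
      ... | no  _           = refl

      path-end : ∀ u t → t ∈ W → t ∉ X → t ≢ w → degree t (path u t) ≡ δ t u
      path-end u t t∈W t∉X t≢w with path? u
      ... | yes (u∈W , u∉X) = endpoints (pathTo u u∈W u∉X) t t≢w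
      ... | no  ¬u          = trans (degree-0 t) (≡-sym (dec-false (t ≟ u) λ { refl → ¬u (t∈W , t∉X) }))

    -- `Z₀` copies the rows of `D` at `X` and mirrors them into the columns. A T-join avoiding `X`
    -- then corrects the remaining defect, the sum of the degrees of `Z₀` and `U`.
    T-join-extending : (U : V G → Bool) (D : V G → V G → Bool) → Σ (V G → V G → Bool) λ Z →
      (∀ s t → E s t → Z s t ≡ Z t s) × (∀ s t → s ∈ X → Z s t ≡ D s t)
      × (∀ t → t ∈ W → t ∉ X → t ≢ w → degree t (Z t) ≡ U t)
    T-join-extending U D = (λ s t → Z₀ s t xor Z₁ s t)
      , (λ s t st → cong₂ _xor_ (Z₀-sym s t st) (Z₁-sym s t))
      , (λ s t s∈X → trans (cong₂ _xor_ (Z₀-X s t s∈X) (Z₁-X s t s∈X)) (xor-identityʳ (D s t)))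
      , λ t t∈W t∉X t≢w → begin
          degree t (λ v → Z₀ t v xor Z₁ t v)              ≡⟨ degree-xor t (Z₀ t) (Z₁ t) ⟩
          degree t (Z₀ t) xor degree t (Z₁ t)             ≡⟨ cong (degree t (Z₀ t) xor_) (Z₁-end t t∈W t∉X t≢w) ⟩
          degree t (Z₀ t) xor (degree t (Z₀ t) xor U t)   ≡⟨ xor-assoc (degree t (Z₀ t)) _ (U t) ⟨
          (degree t (Z₀ t) xor degree t (Z₀ t)) xor U t   ≡⟨ cong (_xor U t) (xor-same (degree t (Z₀ t))) ⟩
          U t                                             ∎
      where
      open ≡-Reasoning

      Z₀ : V G → V G → Bool
      Z₀ s t with s ∈? X | t ∈? X
      ... | yes _ | _     = D s t
      ... | no _  | yes _ = D t s
      ... | no _  | no _  = false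

      Z₀-sym : ∀ s t → E s t → Z₀ s t ≡ Z₀ t s
      Z₀-sym s t st with s ∈? X | t ∈? X
      -- Two rows of `D` could disagree only here, but `X` has at most one element.
      ... | yes s∈X | yes t∈X with refl ← ∣p∣≤1⇒x≡y X≤1 s∈X t∈X = refl
      ... | yes _   | no _    = refl
      ... | no _    | yes _   = refl
      ... | no _    | no _    = refl

      Z₀-X : ∀ s t → s ∈ X → Z₀ s t ≡ D s t
      Z₀-X s t s∈X with s ∈? X | t ∈? X
      ... | yes _  | _ = refl
      ... | no s∉X | _ = contradiction s∈X s∉X

      J = T-join (λ t → degree t (Z₀ t) xor U t)
      Z₁ = proj₁ J
      Z₁-sym = proj₁ (proj₂ J)
      Z₁-X = proj₁ (proj₂ (proj₂ J))
      Z₁-end = proj₂ (proj₂ (proj₂ J))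

  -- The identity has no lift

  module _ (1<W : 1 < ∣ W ∣) where

    -- Propagating "equal to `v`, or `v` has an edge" from `v` to another vertex of `W` must use an
    -- edge at `v`.
    nonisolated : ∀ {v} → v ∈ W → ∃ (E v)
    nonisolated {v} v∈W with ∃-outside-image ⁅ v ⁆ id W (≤-trans (≤-reflexive (cong suc (∣⁅x⁆∣≡1 v))) 1<W)
    ... | u , u∈W , u≢ with connected ⊥ (≤-trans (≤-reflexive (∣⊥∣≡0 (size G))) z≤n) v∈W ∉⊥ (λ u → v ≡ u ⊎ ∃ (E v))
                              (inj₁ refl)
                              (λ { x y _ _ xy (inj₁ refl) → inj₂ (y , xy) ; x y _ _ xy (inj₂ e) → inj₂ e }) u u∈W ∉⊥
    ... | inj₁ v≡u = contradiction v≡u (u≢ v (x∈⁅x⁆ v))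
    ... | inj₂ e   = e

    -- A lift would give a symmetric edge set inside `W`, whose degrees sum to 0 modulo 2, while the
    -- prescribed parities sum to 1.
    ¬Lift-id : ∀ {v} → v ∈ W → ¬ (Σ _ (Lift (λ u → δ u v) G id))
    ¬Lift-id {v} v∈W (ζ , l) = contradiction (begin
      true                                                 ≡⟨ sum-δ (λ _ → true) v ⟨
      sum (λ u → δ u v)                                    ≡⟨ sum-cong-≗ deg ⟨
      sum (λ u → sum (λ t → does (E? u t) ∧ ζ u t))
          ≡⟨ sum-symmetric (λ u t → does (E? u t) ∧ ζ u t) h-sym (λ u → cong (_∧ ζ u u) (dec-false (E? u u) E-irrefl)) ⟩
      false                                                ∎) λ ()
      where
      open ≡-Reasoning
      deg : ∀ u → degree u (ζ u) ≡ δ u v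
      deg u = by-cases (u ∈? W)
        where
        by-cases : Dec (u ∈ W) → degree u (ζ u) ≡ δ u v
        -- `Lift` constrains the degree only at an end of an edge, so an edge at `u` has to be
        -- supplied.
        by-cases (yes u∈W) = let (t , ut) = nonisolated u∈W in proj₁ (l u t (proj₁ ut))
        by-cases (no  u∉W) =
          trans (degree-∉ (ζ u) u∉W) (≡-sym (dec-false (u ≟ v) λ u≡v → u∉W (subst (_∈ W) (≡-sym u≡v) v∈W)))
      h-sym : ∀ u t → does (E? u t) ∧ ζ u t ≡ does (E? t u) ∧ ζ t u
      h-sym u t = trans (does-∧-cong (E? u t) (λ ut → proj₂ (l u t (proj₁ ut)) ut))
        (cong (_∧ ζ t u) (does-⇔ (mk⇔ E-sym E-sym) (E? u t) (E? t u)))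

  -- Lifting bag by bag

  module _ {F : Graph} (D : TreeDecomposition F) (adhesion : AdhesionAtMost 1 D) (bag<W : ∀ t → ∣ bag D t ∣ < ∣ W ∣)
           (U : V G → Bool) (U-∉ : ∀ {t} → t ∉ W → U t ≡ false) (φ : V F → V G) where

    private
      -- Agreement is required of all pairs in a common bag, adjacent in `F` or not: each bag is
      -- lifted as if it were a clique.
      Partial : Subset (size (T D)) → (V F → V G → Bool) → Set
      Partial R ζ = (∀ x → Covered D R x → degree (φ x) (ζ x) ≡ U (φ x))
        × (∀ t → t ∈ R → ∀ x y → x ∈ bag D t → y ∈ bag D t → E (φ x) (φ y) → ζ x (φ y) ≡ ζ y (φ x))

      covered? : ∀ R x → Dec (Covered D R x)
      covered? R x = any? λ s → (s ∈? R) ×-dec (x ∈? bag D s)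

      module _ (R : Subset (size (T D))) (t : V (T D)) (ζ : V F → V G → Bool) (partial : Partial R ζ)
               (once : ∀ u v → u ∈ bag D t → v ∈ bag D t → Covered D R u → Covered D R v → u ≡ v) where

        -- One edge set `Z` labels the whole bag through its image. The bag is smaller than `W`, so
        -- some `w` in `W` lies outside the image and can absorb the parity defect; if a vertex `c`
        -- of the bag is already covered, its label is the prescribed row.
        bag-join : Σ (V G → V G → Bool) λ Z → (∀ u v → E u v → Z u v ≡ Z v u)
          × (∀ x → x ∈ bag D t → Covered D R x → ∀ v → Z (φ x) v ≡ ζ x v)
          × (∀ x → x ∈ bag D t → degree (φ x) (Z (φ x)) ≡ U (φ x))
        bag-join with ∃-outside-image (bag D t) φ W (bag<W t) | any? (λ c → (c ∈? bag D t) ×-dec covered? R c)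
        ... | w , w∈W , missed | no none =
          let (Z , Z-sym , _ , Z-deg) = T-join-extending ⊥
                    (≤-trans (≤-reflexive (∣⊥∣≡0 (size G))) z≤n) w∈W ∉⊥ U (λ _ _ → false)
              deg : ∀ x → x ∈ bag D t → Dec (φ x ∈ W) → degree (φ x) (Z (φ x)) ≡ U (φ x)
              deg x x∈t = λ { (yes φx∈W) → Z-deg (φ x) φx∈W ∉⊥ (missed x x∈t)
                            ; (no φx∉W) → trans (degree-∉ (Z (φ x)) φx∉W) (≡-sym (U-∉ φx∉W)) }
          in Z , Z-sym , (λ x x∈t x∈R → contradiction (x , x∈t , x∈R) none) , λ x x∈t → deg x x∈t (φ x ∈? W)
        ... | w , w∈W , missed | yes (c , c∈t , c∈R) =
          let (Z , Z-sym , Z-X , Z-deg) = T-join-extending ⁅ φ c ⁆ (≤-reflexive (∣⁅x⁆∣≡1 (φ c))) w∈W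
                (λ w∈ → missed c c∈t (≡-sym (x∈⁅y⁆⇒x≡y (φ c) w∈))) U (λ _ → ζ c)
              deg : ∀ x → x ∈ bag D t → Dec (φ x ≡ φ c) → Dec (φ x ∈ W) → degree (φ x) (Z (φ x)) ≡ U (φ x)
              -- Where the image is that of `c` the row is prescribed, and its parity is right
              -- because `c` was already lifted.
              deg x x∈t = λ { (yes eq) _ → trans
                  (degree-cong (φ x) (λ v _ → Z-X (φ x) v (subst (φ x ∈_) (cong ⁅_⁆ eq) (x∈⁅x⁆ (φ x)))))
                                             (subst (λ z → degree z (ζ c) ≡ U z) (≡-sym eq) (proj₁ partial c c∈R))
                            ; (no ne) (yes φx∈W) → Z-deg (φ x) φx∈W (λ φx∈ → ne (x∈⁅y⁆⇒x≡y (φ c) φx∈)) (missed x x∈t)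
                            ; (no _) (no φx∉W) → trans (degree-∉ (Z (φ x)) φx∉W) (≡-sym (U-∉ φx∉W)) }
          in Z , Z-sym
             , (λ { x x∈t x∈R v → trans
                 (Z-X (φ x) v (subst (λ z → φ x ∈ ⁅ φ z ⁆) (once x c x∈t c∈t x∈R c∈R) (x∈⁅x⁆ (φ x))))
                                        (cong (λ z → ζ z v) (once c x c∈t x∈t c∈R x∈R)) })
             , λ x x∈t → deg x x∈t (φ x ≟ φ c) (φ x ∈? W)

        extend-partial : Σ _ (Partial (R ∪ ⁅ t ⁆))
        extend-partial = ζ' , valid , consistent
          where
          Z = proj₁ bag-join
          Z-sym = proj₁ (proj₂ bag-join)
          Z-covered = proj₁ (proj₂ (proj₂ bag-join))
          Z-degree = proj₂ (proj₂ (proj₂ bag-join))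

          ζ' : V F → V G → Bool
          ζ' x with covered? R x
          ... | yes _ = ζ x
          ... | no  _ = Z (φ x)

          ζ'-covered : ∀ x → Covered D R x → ζ' x ≡ ζ x
          ζ'-covered x x∈R with covered? R x
          ... | yes _  = refl
          ... | no x∉R = contradiction x∈R x∉R

          ζ'-bag : ∀ x → x ∈ bag D t → ζ' x ≗ Z (φ x)
          ζ'-bag x x∈t v with covered? R x
          ... | yes x∈R = ≡-sym (Z-covered x x∈t x∈R v)
          ... | no  _   = refl

          valid : ∀ x → Covered D (R ∪ ⁅ t ⁆) x → degree (φ x) (ζ' x) ≡ U (φ x)
          valid x (s , s∈ , x∈s) with x∈p∪q⁻ R ⁅ t ⁆ s∈
          ... | inj₁ s∈R =
            trans (cong (degree (φ x)) (ζ'-covered x (s , s∈R , x∈s))) (proj₁ partial x (s , s∈R , x∈s))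
          ... | inj₂ s∈t with refl ← x∈⁅y⁆⇒x≡y t s∈t =
            trans (degree-cong (φ x) (λ v _ → ζ'-bag x x∈s v)) (Z-degree x x∈s)

          consistent : ∀ s → s ∈ R ∪ ⁅ t ⁆ → ∀ x y → x ∈ bag D s → y ∈ bag D s → E (φ x) (φ y) →
            ζ' x (φ y) ≡ ζ' y (φ x)
          consistent s s∈ x y x∈s y∈s e with x∈p∪q⁻ R ⁅ t ⁆ s∈
          ... | inj₁ s∈R = trans (cong (λ S → S (φ y)) (ζ'-covered x (s , s∈R , x∈s)))
            (trans (proj₂ partial s s∈R x y x∈s y∈s e) (cong (λ S → S (φ x)) (≡-sym (ζ'-covered y (s , s∈R , y∈s)))))
          ... | inj₂ s∈t with refl ← x∈⁅y⁆⇒x≡y t s∈t =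
            trans (ζ'-bag x x∈s (φ y)) (trans (Z-sym (φ x) (φ y) e) (≡-sym (ζ'-bag y y∈s (φ x))))

    lift : Σ _ (Lift U F φ)
    lift = let (ζ , valid , consistent) = everywhere in ζ , λ x y xy →
      let (t , x∈t , y∈t) = edgeIn D x y xy in valid x (t , ∈⊤ , x∈t) , consistent t ∈⊤ x y x∈t y∈t
      where
      everywhere : Σ _ (Partial ⊤)
      everywhere = tree-growth D adhesion (λ R → Σ _ (Partial R))
        ((λ _ _ → false) , (λ x (_ , s∈⊥ , _) → contradiction s∈⊥ ∉⊥) , λ t t∈⊥ → contradiction t∈⊥ ∉⊥)
        (λ R t once (ζ , partial) → extend-partial R t ζ partial once)

-- Decomposing along separations

argmax : ∀ {n} (f : Fin (suc n) → ℕ) → ∃ λ i → ∀ j → f j ≤ f i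
argmax {zero}  f = zero , λ { zero → ≤-refl }
argmax {suc n} f with argmax (f ∘ suc)
... | i , max with ≤-total (f zero) (f (suc i))
... | inj₁ ≤i = suc i , λ { zero → ≤i ; (suc j) → max j }
... | inj₂ ≥i = zero  , λ { zero → ≤-refl ; (suc j) → ≤-trans (max j) ≥i }

-- The largest vertex of a cycle would have two smaller neighbours.
UniqueParent : Graph → Set
UniqueParent T = ∀ {i j j'} → Adj T i j → Adj T i j' → toℕ j ≤ toℕ i → toℕ j' ≤ toℕ i → j ≡ j'

module _ {T : Graph} (c : Cycle T) where
  open Cycle c

  cycle-neighbours : ∀ i → ∃ λ p → ∃ λ q → p ≢ q × Adj T (vs i) (vs p) × Adj T (vs i) (vs q)
  cycle-neighbours zero    = suc zero , fromℕ (suc (suc m)) , (λ ()) , edges zero , trans (sym T _ _) close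
  cycle-neighbours (suc j) with view j
  ... | ‵fromℕ      = inject₁ (fromℕ (suc m)) , zero , (λ ()) , trans (sym T _ _) (edges (fromℕ (suc m))) , close
  ... | ‵inject₁ j' =
    inject₁ (inject₁ j') , suc (suc j') , distinct , trans (sym T _ _) (edges (inject₁ j')) , edges (suc j')
    where
    distinct : inject₁ (inject₁ j') ≢ suc (suc j')
    distinct eq =
      m≢1+n+m (toℕ j') {1} (trans (≡-sym (trans (toℕ-inject₁ (inject₁ j')) (toℕ-inject₁ j'))) (cong toℕ eq))

uniqueParent⇒acyclic : ∀ {T} → UniqueParent T → ¬ Cycle T
uniqueParent⇒acyclic {T} unique c with argmax (toℕ ∘ Cycle.vs c)
... | i , max with cycle-neighbours c i
... | p , q , p≢q , ip , iq = p≢q (Cycle.inj c p q (unique ip iq (max p) (max q)))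

-- Joining two trees by an edge

module Glue (T₁ T₂ : Graph) (a : V T₁) (r : V T₂) where

  private
    link : V T₁ ⊎ V T₂ → V T₁ ⊎ V T₂ → Bool
    link (inj₁ i) (inj₁ j) = adj T₁ i j
    link (inj₁ i) (inj₂ j) = δ i a ∧ δ j r
    link (inj₂ i) (inj₁ j) = δ j a ∧ δ i r
    link (inj₂ i) (inj₂ j) = adj T₂ i j

    link-sym : ∀ x y → link x y ≡ link y x
    link-sym (inj₁ i) (inj₁ j) = sym T₁ i j
    link-sym (inj₁ i) (inj₂ j) = refl
    link-sym (inj₂ i) (inj₁ j) = refl
    link-sym (inj₂ i) (inj₂ j) = sym T₂ i j

    link-irrefl : ∀ x → link x x ≡ false
    link-irrefl (inj₁ i) = loopless T₁ i
    link-irrefl (inj₂ i) = loopless T₂ i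

    split : Fin (size T₁ + size T₂) → V T₁ ⊎ V T₂
    split = splitAt (size T₁)

  glue : Graph
  glue = record
    { size     = size T₁ + size T₂
    ; adj      = λ i j → link (split i) (split j)
    ; sym      = λ i j → link-sym (split i) (split j)
    ; loopless = λ i → link-irrefl (split i)
    }

  inl : V T₁ → V glue
  inl i = i ↑ˡ size T₂

  inr : V T₂ → V glue
  inr j = size T₁ ↑ʳ j

  data Side : V glue → Set where
    left  : ∀ i → Side (inl i)
    right : ∀ j → Side (inr j)

  side : ∀ i → Side i
  side i = subst Side (join-splitAt (size T₁) (size T₂) i) (of-join (split i))
    where
    of-join : ∀ x → Side (join (size T₁) (size T₂) x)
    of-join (inj₁ i) = left i
    of-join (inj₂ j) = right j

  private
    split-inl : ∀ i → split (inl i) ≡ inj₁ i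
    split-inl i = splitAt-↑ˡ (size T₁) i (size T₂)

    split-inr : ∀ j → split (inr j) ≡ inj₂ j
    split-inr j = splitAt-↑ʳ (size T₁) (size T₂) j

  copair : ∀ {A : Set} → (V T₁ → A) → (V T₂ → A) → V glue → A
  copair f g i = [ f , g ]′ (split i)

  copair-inl : ∀ {A : Set} (f : V T₁ → A) (g : V T₂ → A) i → copair f g (inl i) ≡ f i
  copair-inl f g i = cong [ f , g ]′ (split-inl i)

  copair-inr : ∀ {A : Set} (f : V T₁ → A) (g : V T₂ → A) j → copair f g (inr j) ≡ g j
  copair-inr f g j = cong [ f , g ]′ (split-inr j)

  adj-ll : ∀ i j → adj glue (inl i) (inl j) ≡ adj T₁ i j
  adj-ll i j = cong₂ link (split-inl i) (split-inl j)

  adj-rr : ∀ i j → adj glue (inr i) (inr j) ≡ adj T₂ i j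
  adj-rr i j = cong₂ link (split-inr i) (split-inr j)

  adj-lr : ∀ i j → adj glue (inl i) (inr j) ≡ δ i a ∧ δ j r
  adj-lr i j = cong₂ link (split-inl i) (split-inr j)

  bridge : Adj glue (inl a) (inr r)
  bridge = trans (adj-lr a r) (cong₂ _∧_ (dec-true (a ≟ a) refl) (dec-true (r ≟ r) refl))

  bridge-only : ∀ {i j} → Adj glue (inl i) (inr j) → i ≡ a × j ≡ r
  bridge-only {i} {j} e = ends (i ≟ a) (j ≟ r) (trans (≡-sym (adj-lr i j)) e)
    where
    ends : (p? : Dec (i ≡ a)) (q? : Dec (j ≡ r)) → does p? ∧ does q? ≡ true → i ≡ a × j ≡ r
    ends (yes p) (yes q) _ = p , q

  module _ {Q : V glue → Set} where

    walk-inl : ∀ {P : V T₁ → Set} {s t} → (∀ {i} → P i → Q (inl i)) → WalkIn T₁ P s t → WalkIn glue Q (inl s) (inl t)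
    walk-inl f (here p)     = here (f p)
    walk-inl f (step p e w) = step (f p) (trans (adj-ll _ _) e) (walk-inl f w)

    walk-inr : ∀ {P : V T₂ → Set} {s t} → (∀ {i} → P i → Q (inr i)) → WalkIn T₂ P s t → WalkIn glue Q (inr s) (inr t)
    walk-inr f (here p)     = here (f p)
    walk-inr f (step p e w) = step (f p) (trans (adj-rr _ _) e) (walk-inr f w)

    walk-lr : ∀ {s t} → Q (inl a) → WalkIn glue Q (inl s) (inl a) → WalkIn glue Q (inr r) (inr t) →
      WalkIn glue Q (inl s) (inr t)
    walk-lr qa v w = v ++ʷ step qa bridge w

    walk-rl : ∀ {s t} → Q (inr r) → WalkIn glue Q (inr s) (inr r) → WalkIn glue Q (inl a) (inl t) →
      WalkIn glue Q (inr s) (inl t)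
    walk-rl qr v w = v ++ʷ step qr (trans (sym glue (inr r) (inl a)) bridge) w

  glue-connected : Connected T₁ → Connected T₂ → Connected glue
  glue-connected c₁ c₂ s t with side s | side t
  ... | left i  | left j  = walk-inl id (c₁ i j)
  ... | left i  | right j = walk-lr _ (walk-inl id (c₁ i a)) (walk-inr id (c₂ r j))
  ... | right i | left j  = walk-rl _ (walk-inr id (c₂ i r)) (walk-inl id (c₁ a j))
  ... | right i | right j = walk-inr id (c₂ i j)

  -- Vertices of `T₁` are numbered first, so the bridge makes `a` the parent of `r`; being 0 in
  -- `T₂`, the vertex `r` had no parent before.
  glue-uniqueParent : toℕ r ≡ 0 → UniqueParent T₁ → UniqueParent T₂ → UniqueParent glue
  glue-uniqueParent r≡0 u₁ u₂ {i} {j} {j'} = cases (side i) (side j) (side j')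
    where
    ↑ˡ-≤ : ∀ {x y} → toℕ (inl x) ≤ toℕ (inl y) → toℕ x ≤ toℕ y
    ↑ˡ-≤ {x} {y} le = subst₂ _≤_ (toℕ-↑ˡ x (size T₂)) (toℕ-↑ˡ y (size T₂)) le

    ↑ʳ-≤ : ∀ {x y} → toℕ (inr x) ≤ toℕ (inr y) → toℕ x ≤ toℕ y
    ↑ʳ-≤ {x} {y} le = +-cancelˡ-≤ (size T₁) _ _ (subst₂ _≤_ (toℕ-↑ʳ (size T₁) x) (toℕ-↑ʳ (size T₁) y) le)

    inr≰inl : ∀ {x y} → ¬ toℕ (inr x) ≤ toℕ (inl y)
    inr≰inl {x} {y} le = <⇒≱ (toℕ<n y)
      (≤-trans (m≤m+n (size T₁) (toℕ x)) (subst₂ _≤_ (toℕ-↑ʳ (size T₁) x) (toℕ-↑ˡ y (size T₂)) le))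

    flip-lr : ∀ {x y} → Adj glue (inr x) (inl y) → y ≡ a × x ≡ r
    flip-lr {x} {y} e = bridge-only (trans (sym glue (inl y) (inr x)) e)

    root-minimal : ∀ {x} → Adj T₂ r x → ¬ toℕ x ≤ toℕ r
    root-minimal {x} e le
      with refl ← toℕ-injective {i = x} {r} (trans (n≤0⇒n≡0 (subst (toℕ x ≤_) r≡0 le)) (≡-sym r≡0)) =
      contradiction (trans (≡-sym e) (loopless T₂ x)) λ ()

    cases : ∀ {i j j'} → Side i → Side j → Side j' → Adj glue i j → Adj glue i j' → toℕ j ≤ toℕ i →
      toℕ j' ≤ toℕ i → j ≡ j'
    cases (left i)  (left j)  (left j')  e e' le le' =
      cong inl (u₁ (trans (≡-sym (adj-ll i j)) e) (trans (≡-sym (adj-ll i j')) e') (↑ˡ-≤ le) (↑ˡ-≤ le'))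
    cases (left i)  (right j) _          e e' le le' = contradiction le inr≰inl
    cases (left i)  (left j)  (right j') e e' le le' = contradiction le' inr≰inl
    cases (right i) (left j)  (left j')  e e' le le' =
      cong inl (trans (proj₁ (flip-lr e)) (≡-sym (proj₁ (flip-lr e'))))
    cases (right i) (left j)  (right j') e e' le le' with refl ← proj₂ (flip-lr e) =
      contradiction (↑ʳ-≤ le') (root-minimal (trans (≡-sym (adj-rr i j')) e'))
    cases (right i) (right j) (left j')  e e' le le' with refl ← proj₂ (flip-lr e') =
      contradiction (↑ʳ-≤ le) (root-minimal (trans (≡-sym (adj-rr i j)) e))
    cases (right i) (right j) (right j') e e' le le' =
      cong inr (u₂ (trans (≡-sym (adj-rr i j)) e) (trans (≡-sym (adj-rr i j')) e') (↑ʳ-≤ le) (↑ʳ-≤ le'))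

-- Gluing decompositions along a separation

module _ (G : Graph) (k : ℕ) where

  -- Decomposes the subgraph induced by `W`. Acyclicity is carried as `UniqueParent` with the root
  -- numbered 0, a form preserved by gluing.
  record RootedDecomposition (W X : Subset (size G)) : Set where
    field
      tree         : Graph
      root         : V tree
      root≡0       : toℕ root ≡ 0
      uniqueParent : UniqueParent tree
      conn         : Connected tree
      bags         : V tree → Subset (size G)
      bags⊆        : ∀ t → bags t ⊆ W
      covering     : ∀ v → v ∈ W → ∃ λ t → v ∈ bags t
      edge-in      : ∀ u v → u ∈ W → v ∈ W → Adj G u v → ∃ λ t → u ∈ bags t × v ∈ bags t
      sub-tree     : ∀ v s s' → v ∈ bags s → v ∈ bags s' → WalkIn tree (λ t → v ∈ bags t) s s'
      width        : ∀ t → ∣ bags t ∣ ≤ suc k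
      adh          : ∀ s t → Adj tree s t → ∣ bags s ∩ bags t ∣ ≤ 1
      root-bag     : X ⊆ bags root
  open RootedDecomposition

  single-bag : ∀ {W X} → ∣ W ∣ ≤ suc k → X ⊆ W → RootedDecomposition W X
  single-bag {W} W≤ X⊆W = record
    { tree         = record { size = 1 ; adj = λ _ _ → false ; sym = λ _ _ → refl ; loopless = λ _ → refl }
    ; root         = zero
    ; root≡0       = refl
    ; uniqueParent = λ ()
    ; conn         = λ { zero zero → here _ }
    ; bags         = λ _ → W
    ; bags⊆        = λ _ → id
    ; covering     = λ v v∈W → zero , v∈W
    ; edge-in      = λ u v u∈W v∈W _ → zero , u∈W , v∈W
    ; sub-tree     = λ { v zero zero v∈W _ → here v∈W }
    ; width        = λ _ → W≤
    ; adh          = λ _ _ ()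
    ; root-bag     = X⊆W
    }

  Separates-swap : ∀ {W A B} → Separates G W A B → Separates G W B A
  Separates-swap {W} {A} {B} ((A⊂W , B⊂W , W⊆) , A∩B≤1 , edge) =
    (B⊂W , A⊂W , subst (λ C → W ⊆ C) (∪-comm A B) W⊆)
    , subst (λ C → ∣ C ∣ ≤ 1) (∩-comm A B) A∩B≤1
    , λ u v u∈B v∈A uv → [ inj₂ , inj₁ ]′ (edge v u v∈A u∈B (trans (sym G v u) uv))

  -- The bridge joins two nodes whose bags both contain `A ∩ B`, so the nodes holding a shared
  -- vertex stay connected. Bags of different sides meet inside `A ∩ B`, which bounds the adhesion.
  glue-decompositions : ∀ {W X A B} → Separates G W A B →
    RootedDecomposition A X → RootedDecomposition B (A ∩ B) → RootedDecomposition W X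
  glue-decompositions {W} {X} {A} {B} ((A⊂W , B⊂W , W⊆A∪B) , A∩B≤1 , edge) D₁ D₂ = record
    { tree         = glue
    ; root         = inl (root D₁)
    ; root≡0       = trans (toℕ-↑ˡ (root D₁) _) (root≡0 D₁)
    ; uniqueParent = λ {i} {j} {j'} → glue-uniqueParent (root≡0 D₂) (uniqueParent D₁) (uniqueParent D₂) {i} {j} {j'}
    ; conn         = glue-connected (conn D₁) (conn D₂)
    ; bags         = bags'
    ; bags⊆        = λ t → bags'⊆ (side t)
    ; covering     = λ v v∈W → covering' (x∈p∪q⁻ A B (W⊆A∪B v∈W))
    ; edge-in      = λ u v u∈W v∈W uv → edge-in' uv (x∈p∪q⁻ A B (W⊆A∪B u∈W)) (x∈p∪q⁻ A B (W⊆A∪B v∈W))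
    ; sub-tree     = λ v s s' → sub-tree' (side s) (side s')
    ; width        = λ t → width' (side t)
    ; adh          = λ s t → adh' (side s) (side t)
    ; root-bag     = λ x∈X → ∈-inl⁺ (root-bag D₁ x∈X)
    }
    where
    hub : ∃ λ a → A ∩ B ⊆ bags D₁ a
    -- A bag covering one element of `A ∩ B` contains all of it, as there is at most one.
    hub with nonempty? (A ∩ B)
    ... | yes (c , c∈) = let (a , c∈a) = covering D₁ c (proj₁ (x∈p∩q⁻ A B c∈)) in
                         a , λ x∈ → subst (_∈ bags D₁ a) (∣p∣≤1⇒x≡y A∩B≤1 c∈ x∈) c∈a
    ... | no empty     = root D₁ , λ x∈ → contradiction (_ , x∈) empty

    a = proj₁ hub
    open Glue (tree D₁) (tree D₂) a (root D₂)

    bags' : V glue → Subset (size G)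
    bags' = copair (bags D₁) (bags D₂)

    bags'-inl : ∀ i → bags' (inl i) ≡ bags D₁ i
    bags'-inl = copair-inl (bags D₁) (bags D₂)

    bags'-inr : ∀ j → bags' (inr j) ≡ bags D₂ j
    bags'-inr = copair-inr (bags D₁) (bags D₂)

    ∈-inl⁺ : ∀ {v i} → v ∈ bags D₁ i → v ∈ bags' (inl i)
    ∈-inl⁺ {v} {i} = subst (v ∈_) (≡-sym (bags'-inl i))

    ∈-inl⁻ : ∀ {v i} → v ∈ bags' (inl i) → v ∈ bags D₁ i
    ∈-inl⁻ {v} {i} = subst (v ∈_) (bags'-inl i)

    ∈-inr⁺ : ∀ {v j} → v ∈ bags D₂ j → v ∈ bags' (inr j)
    ∈-inr⁺ {v} {j} = subst (v ∈_) (≡-sym (bags'-inr j))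

    ∈-inr⁻ : ∀ {v j} → v ∈ bags' (inr j) → v ∈ bags D₂ j
    ∈-inr⁻ {v} {j} = subst (v ∈_) (bags'-inr j)

    bags'⊆ : ∀ {t} → Side t → bags' t ⊆ W
    bags'⊆ (left i)  v∈ = p⊂q⇒p⊆q A⊂W (bags⊆ D₁ i (∈-inl⁻ v∈))
    bags'⊆ (right j) v∈ = p⊂q⇒p⊆q B⊂W (bags⊆ D₂ j (∈-inr⁻ v∈))

    covering' : ∀ {v} → v ∈ A ⊎ v ∈ B → ∃ λ t → v ∈ bags' t
    covering' (inj₁ v∈A) = let (t , v∈t) = covering D₁ _ v∈A in inl t , ∈-inl⁺ v∈t
    covering' (inj₂ v∈B) = let (t , v∈t) = covering D₂ _ v∈B in inr t , ∈-inr⁺ v∈t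

    in-A : ∀ {u v} → Adj G u v → u ∈ A → v ∈ A → ∃ λ t → u ∈ bags' t × v ∈ bags' t
    in-A uv u∈A v∈A = let (t , u∈t , v∈t) = edge-in D₁ _ _ u∈A v∈A uv in inl t , ∈-inl⁺ u∈t , ∈-inl⁺ v∈t

    in-B : ∀ {u v} → Adj G u v → u ∈ B → v ∈ B → ∃ λ t → u ∈ bags' t × v ∈ bags' t
    in-B uv u∈B v∈B = let (t , u∈t , v∈t) = edge-in D₂ _ _ u∈B v∈B uv in inr t , ∈-inr⁺ u∈t , ∈-inr⁺ v∈t

    edge-in' : ∀ {u v} → Adj G u v → u ∈ A ⊎ u ∈ B → v ∈ A ⊎ v ∈ B → ∃ λ t → u ∈ bags' t × v ∈ bags' t
    edge-in' uv (inj₁ u∈A) (inj₁ v∈A) = in-A uv u∈A v∈A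
    edge-in' uv (inj₂ u∈B) (inj₂ v∈B) = in-B uv u∈B v∈B
    edge-in' {u} {v} uv (inj₁ u∈A) (inj₂ v∈B) = [ (λ u∈B → in-B uv u∈B v∈B) , in-A uv u∈A ]′ (edge u v u∈A v∈B uv)
    edge-in' {u} {v} uv (inj₂ u∈B) (inj₁ v∈A) =
      [ in-B uv u∈B , (λ u∈A → in-A uv u∈A v∈A) ]′ (edge v u v∈A u∈B (trans (sym G v u) uv))

    shared : ∀ {v i j} → v ∈ bags D₁ i → v ∈ bags D₂ j → v ∈ A ∩ B
    shared v∈i v∈j = x∈p∩q⁺ (bags⊆ D₁ _ v∈i , bags⊆ D₂ _ v∈j)

    sub-tree' : ∀ {v s s'} → Side s → Side s' → v ∈ bags' s → v ∈ bags' s' → WalkIn glue (λ t → v ∈ bags' t) s s'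
    sub-tree' {v} (left i)  (left j)  v∈i v∈j = walk-inl ∈-inl⁺ (sub-tree D₁ v i j (∈-inl⁻ v∈i) (∈-inl⁻ v∈j))
    sub-tree' {v} (right i) (right j) v∈i v∈j = walk-inr ∈-inr⁺ (sub-tree D₂ v i j (∈-inr⁻ v∈i) (∈-inr⁻ v∈j))
    sub-tree' {v} (left i)  (right j) v∈i v∈j = walk-lr (∈-inl⁺ v∈a)
        (walk-inl ∈-inl⁺ (sub-tree D₁ v i a (∈-inl⁻ v∈i) v∈a))
            (walk-inr ∈-inr⁺ (sub-tree D₂ v (root D₂) j v∈r (∈-inr⁻ v∈j)))
      where
      v∈a = proj₂ hub (shared (∈-inl⁻ v∈i) (∈-inr⁻ v∈j))
      v∈r = root-bag D₂ (shared (∈-inl⁻ v∈i) (∈-inr⁻ v∈j))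
    sub-tree' {v} (right i) (left j)  v∈i v∈j = walk-rl (∈-inr⁺ v∈r)
        (walk-inr ∈-inr⁺ (sub-tree D₂ v i (root D₂) (∈-inr⁻ v∈i) v∈r))
            (walk-inl ∈-inl⁺ (sub-tree D₁ v a j v∈a (∈-inl⁻ v∈j)))
      where
      v∈a = proj₂ hub (shared (∈-inl⁻ v∈j) (∈-inr⁻ v∈i))
      v∈r = root-bag D₂ (shared (∈-inl⁻ v∈j) (∈-inr⁻ v∈i))

    width' : ∀ {t} → Side t → ∣ bags' t ∣ ≤ suc k
    width' (left i)  = subst (λ b → ∣ b ∣ ≤ suc k) (≡-sym (bags'-inl i)) (width D₁ i)
    width' (right j) = subst (λ b → ∣ b ∣ ≤ suc k) (≡-sym (bags'-inr j)) (width D₂ j)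

    crossing : ∀ i j → ∣ bags' (inl i) ∩ bags' (inr j) ∣ ≤ 1
    crossing i j = ≤-trans
      (p⊆q⇒∣p∣≤∣q∣ λ v∈ → let (v∈i , v∈j) = x∈p∩q⁻ (bags' (inl i)) (bags' (inr j)) v∈
                          in shared (∈-inl⁻ v∈i) (∈-inr⁻ v∈j))
      A∩B≤1

    adh' : ∀ {s t} → Side s → Side t → Adj glue s t → ∣ bags' s ∩ bags' t ∣ ≤ 1
    adh' (left i)  (left j)  e = subst₂ (λ b c → ∣ b ∩ c ∣ ≤ 1) (≡-sym (bags'-inl i)) (≡-sym (bags'-inl j))
        (adh D₁ i j (trans (≡-sym (adj-ll i j)) e))
    adh' (right i) (right j) e = subst₂ (λ b c → ∣ b ∩ c ∣ ≤ 1) (≡-sym (bags'-inr i)) (≡-sym (bags'-inr j))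
        (adh D₂ i j (trans (≡-sym (adj-rr i j)) e))
    adh' (left i)  (right j) e = crossing i j
    adh' (right i) (left j)  e = subst (λ C → ∣ C ∣ ≤ 1) (∩-comm (bags' (inl j)) (bags' (inr i))) (crossing j i)

  module _ (small-or-separable : ∀ W → ∣ W ∣ ≤ suc k ⊎ Separable G W) where

    -- Having at most one element, `X` lies within one side. That side supplies the root, and the
    -- other is decomposed with the common part in its root bag.
    decompose : ∀ W → Acc _⊂_ W → ∀ X → ∣ X ∣ ≤ 1 → X ⊆ W → RootedDecomposition W X
    decompose W (acc rec) X X≤1 X⊆W with small-or-separable W
    ... | inj₁ W≤ = single-bag W≤ X⊆W
    ... | inj₂ (A , B , sep@((A⊂W , B⊂W , W⊆A∪B) , A∩B≤1 , _)) with X ⊆? A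
    ... | yes X⊆A =
      glue-decompositions sep (decompose A (rec A⊂W) X X≤1 X⊆A) (decompose B (rec B⊂W) (A ∩ B) A∩B≤1 (p∩q⊆q A B))
    ... | no X⊈A  = glue-decompositions (Separates-swap sep) (decompose B (rec B⊂W) X X≤1 X⊆B)
                      (decompose A (rec A⊂W) (B ∩ A) (subst (λ C → ∣ C ∣ ≤ 1) (∩-comm A B) A∩B≤1) (p∩q⊆q B A))
      where
      X⊆B : X ⊆ B
      X⊆B {x} x∈X with x∈p∪q⁻ A B (W⊆A∪B (X⊆W x∈X))
      ... | inj₂ x∈B = x∈B
      ... | inj₁ x∈A = contradiction (λ {y} y∈X → subst (_∈ A) (∣p∣≤1⇒x≡y X≤1 x∈X y∈X) x∈A) X⊈A

    decomposable : TW-Adh1 k G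
    decomposable = record
      { T       = tree D
      ; isTree  = conn D , uniqueParent⇒acyclic (λ {i} {j} {j'} → uniqueParent D {i} {j} {j'})
      ; bag     = bags D
      ; covers  = λ v → covering D v ∈⊤
      ; edgeIn  = λ u v → edge-in D u v ∈⊤ ∈⊤
      ; subtree = sub-tree D
      } , width D , adh D
      where
      D = decompose ⊤ (⊂-wellFounded ⊤) ⊥ (≤-trans (≤-reflexive (∣⊥∣≡0 (size G))) z≤n) (λ x∈⊥ → contradiction x∈⊥ ∉⊥)

-- The distinguishing pair of graphs

theorem4p9 : (k : ℕ) → 1 ≤ k → HomDistClosed (TW-Adh1 k)
theorem4p9 k 1≤k F' F'∉ with anySubset? (λ W → (suc (suc k) ≤? ∣ W ∣) ×-dec ¬? (separable? F' W))
... | no none = contradiction (decomposable F' k small-or-separable) F'∉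
  where
  small-or-separable : ∀ W → ∣ W ∣ ≤ suc k ⊎ Separable F' W
  small-or-separable W with suc (suc k) ≤? ∣ W ∣ | separable? F' W
  ... | no W≤   | _       = inj₁ (s≤s⁻¹ (≰⇒> W≤))
  ... | yes _   | yes sep = inj₂ sep
  ... | yes W>k | no ¬sep = contradiction (W , W>k , ¬sep) none
-- Avoiding the image of the empty set just picks an element of the nonempty set `W`.
... | yes (W , W>k , W-insep) with ∃-outside-image ⊥ id W
    (≤-trans (≤-reflexive (cong suc (∣⊥∣≡0 (size F')))) (≤-trans (s≤s z≤n) W>k))
... | v , v∈W , _ = twisted (λ _ → false) , twisted U , indist , distinct
  where
  open Twist F' W
  open Inseparable F' W W-insep

  U : V F' → Bool
  U u = δ u v

  indist : HomIndist (TW-Adh1 k) (twisted (λ _ → false)) (twisted U)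
  indist F (D , width , adhesion) = ≤-antisym
    (hom-twisted-≥ U F λ φ _ → lift D adhesion (λ t → ≤-trans (s≤s (width t)) W>k) U
      (λ {t} t∉W → dec-false (t ≟ v) λ t≡v → t∉W (subst (_∈ W) (≡-sym t≡v) v∈W)) φ)
    (hom-twisted-≤ U F)

  distinct : hom F' (twisted (λ _ → false)) ≢ hom F' (twisted U)
  distinct eq = <⇒≢ (hom-twisted-< U F' id (λ _ _ a → a) (¬Lift-id (≤-trans (s≤s (s≤s z≤n)) W>k) v∈W)) (≡-sym eq)
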